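{- $\vdash P::\mathcal G$ is derivable in $\pi$LL if and only if $\vdash_{\mathrm{CP}}\mathrm{pack}_x(\vdash P::\mathcal G)::x:\bigotimes\mathcal G$ is derivable in CP.
   Context: **$\pi$LL.** Names $x,y,z,\ldots$ come from an infinite set; $X$ ranges over type variables. Types: $A,B::=A\otimes B\mid A\wp B\mid 1\mid\bot\mid A\oplus B\mid A\&B\mid X\mid X^\perp\mid\exists X.A\mid\forall X.A\mid{?}A\mid{!}A$ ($\wp$ is "par"). Processes: $P,Q::=x[y].P\mid x(y).P\mid x[].P\mid x().P\mid x[\mathsf{inl}].P\mid x[\mathsf{inr}].P\mid x\triangleright(P,Q)\mid x[A].P\mid x(X).P\mid{!}x(y).P\mid{?}x[y].P\mid{?}x[x_1,x_2].P\mid{?}x[].P\mid(\nu xy)P\mid P\parallel Q\mid\mathbf 0\mid x\leftrightarrow y$; binding is as usual (names in brackets of a prefix bind in its continuation, $(\nu xy)$ binds $x,y$). Duality is the involution with $(A\otimes B)^\perp=A^\perp\wp B^\perp$, $1^\perp=\bot$, $(A\oplus B)^\perp=A^\perp\&B^\perp$, $({?}A)^\perp={!}A^\perp$, $(\exists X.A)^\perp=\forall X.A^\perp$, $(X)^\perp=X^\perp$, and symmetrically. Environments $\Gamma$ are finite unordered lists of distinct names with types ($\cdot$ is the empty one); hyperenvironments $\mathcal G=\Gamma_1\parallel\cdots\parallel\Gamma_n$ are finite multisets of environments with all names distinct, $\emptyset$ being the one with no environments ("," binds tighter than $\parallel$). Rules of $\pi$LL (premises $\Rightarrow$ conclusion):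 (Ax) $\vdash x\leftrightarrow y::x:A^\perp,y:A$. (Cut) $\vdash P::\mathcal G\parallel\Gamma,x:A\parallel\Delta,y:A^\perp\Rightarrow\ \vdash(\nu xy)P::\mathcal G\parallel\Gamma,\Delta$. (Mix) $\vdash P::\mathcal G$ and $\vdash Q::\mathcal H\Rightarrow\ \vdash P\parallel Q::\mathcal G\parallel\mathcal H$. (Mix$_0$) $\vdash\mathbf 0::\emptyset$. ($\otimes$) $\vdash P::\Gamma,y:A\parallel\Delta,x:B\Rightarrow\ \vdash x[y].P::\Gamma,\Delta,x:A\otimes B$. (1) $\vdash P::\emptyset\Rightarrow\ \vdash x[].P::x:1$. ($\wp$) $\vdash P::\Gamma,y:A,x:B\Rightarrow\ \vdash x(y).P::\Gamma,x:A\wp B$. ($\bot$) $\vdash P::\Gamma\Rightarrow\ \vdash x().P::\Gamma,x:\bot$. ($\oplus_1$) $\vdash P::\Gamma,x:A\Rightarrow\ \vdash x[\mathsf{inl}].P::\Gamma,x:A\oplus B$. ($\oplus_2$) $\vdash P::\Gamma,x:B\Rightarrow\ \vdash x[\mathsf{inr}].P::\Gamma,x:A\oplus B$. ($\&$) $\vdash P::\Gamma,x:A$ and $\vdash Q::\Gamma,x:B\Rightarrow\ \vdash x\triangleright(P,Q)::\Gamma,x:A\&B$. (!) $\vdash P::{?}\Gamma,y:A\Rightarrow\ \vdash{!}x(y).P::{?}\Gamma,x:{!}A$, where all types in ${?}\Gamma$ have the form ${?}B$. (?) $\vdash P::\Gamma,y:A\Rightarrow\ \vdash{?}x[y].P::\Gamma,x:{?}A$.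 (W) $\vdash P::\Gamma\Rightarrow\ \vdash{?}x[].P::\Gamma,x:{?}A$. (C) $\vdash P::\Gamma,x_1:{?}A,x_2:{?}A\Rightarrow\ \vdash{?}x[x_1,x_2].P::\Gamma,x:{?}A$. ($\exists$) $\vdash P::\Gamma,x:B\{A/X\}\Rightarrow\ \vdash x[A].P::\Gamma,x:\exists X.B$. ($\forall$) $\vdash P::\Gamma,x:B$, $X$ not free in $\Gamma$ $\Rightarrow\ \vdash x(X).P::\Gamma,x:\forall X.B$. **CP** (Classical Processes, i.e. classical linear logic). Judgements $\vdash_{\mathrm{CP}}P::\Gamma$ with a single environment; the rules are (Ax) $\vdash_{\mathrm{CP}}x\leftrightarrow y::x:A^\perp,y:A$; ($\wp$) $\vdash_{\mathrm{CP}}P::\Gamma,y:A,x:B\Rightarrow\ \vdash_{\mathrm{CP}}x(y).P::\Gamma,x:A\wp B$; ($\bot$) $\vdash_{\mathrm{CP}}P::\Gamma\Rightarrow\ \vdash_{\mathrm{CP}}x().P::\Gamma,x:\bot$; ($\oplus_1$) $\vdash_{\mathrm{CP}}P::\Gamma,x:A\Rightarrow\ \vdash_{\mathrm{CP}}x[\mathsf{inl}].P::\Gamma,x:A\oplus B$; ($\oplus_2$) $\vdash_{\mathrm{CP}}P::\Gamma,x:B\Rightarrow\ \vdash_{\mathrm{CP}}x[\mathsf{inr}].P::\Gamma,x:A\oplus B$; ($\&$) $\vdash_{\mathrm{CP}}P::\Gamma,x:A$ and $\vdash_{\mathrm{CP}}Q::\Gamma,x:B\Rightarrow\ \vdash_{\mathrm{CP}}x\triangleright(P,Q)::\Gamma,x:A\&B$;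 (!) $\vdash_{\mathrm{CP}}P::{?}\Gamma,y:A\Rightarrow\ \vdash_{\mathrm{CP}}{!}x(y).P::{?}\Gamma,x:{!}A$, where all types in ${?}\Gamma$ have the form ${?}B$; (?) $\vdash_{\mathrm{CP}}P::\Gamma,y:A\Rightarrow\ \vdash_{\mathrm{CP}}{?}x[y].P::\Gamma,x:{?}A$; (W) $\vdash_{\mathrm{CP}}P::\Gamma\Rightarrow\ \vdash_{\mathrm{CP}}{?}x[].P::\Gamma,x:{?}A$; (C) $\vdash_{\mathrm{CP}}P::\Gamma,x_1:{?}A,x_2:{?}A\Rightarrow\ \vdash_{\mathrm{CP}}{?}x[x_1,x_2].P::\Gamma,x:{?}A$; ($\exists$) $\vdash_{\mathrm{CP}}P::\Gamma,x:B\{A/X\}\Rightarrow\ \vdash_{\mathrm{CP}}x[A].P::\Gamma,x:\exists X.B$; ($\forall$) $\vdash_{\mathrm{CP}}P::\Gamma,x:B$, $X$ not free in $\Gamma$ $\Rightarrow\ \vdash_{\mathrm{CP}}x(X).P::\Gamma,x:\forall X.B$; together with (Cut) $\vdash_{\mathrm{CP}}P::\Gamma,x:A$ and $\vdash_{\mathrm{CP}}Q::\Delta,y:A^\perp\Rightarrow\ \vdash_{\mathrm{CP}}(\nu xy)(P\parallel Q)::\Gamma,\Delta$; ($\otimes$) $\vdash_{\mathrm{CP}}P::\Gamma,y:A$ and $\vdash_{\mathrm{CP}}Q::\Delta,x:B\Rightarrow\ \vdash_{\mathrm{CP}}x[y].(P\parallel Q)::\Gamma,\Delta,x:A\otimes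 B$; (1) $\vdash_{\mathrm{CP}}x[].\mathbf 0::x:1$. There is no Mix or Mix$_0$ rule in CP. **Internalisation** (relative to a fixed enumeration of $\mathcal G$ and its environments): $\mathrm{Par}(\cdot)=\bot$, $\mathrm{Par}(\Gamma,z:A)=A\wp\mathrm{Par}(\Gamma)$; $\bigotimes\emptyset=1$, $\bigotimes(\mathcal G\parallel\Gamma)=\mathrm{Par}(\Gamma)\otimes(\bigotimes\mathcal G)$, where $\mathrm{Par}$ denotes iterated par. **Disentanglement.** Parallel compositions are read modulo associativity, commutativity and unit $\mathbf 0$. $\mathsf{dis}(P)$ is the process obtained by exhaustively applying, anywhere in $P$, the rewritings $P\parallel\mathbf 0\mapsto P$; $(\nu xy)(P\parallel Q)\mapsto(\nu xy)P\parallel Q$ if $x,y\notin\mathrm{fn}(Q)$; $(\nu xy)(P\parallel Q)\mapsto P\parallel(\nu xy)Q$ if $x,y\notin\mathrm{fn}(P)$. Recursively: $\mathsf{dis}$ commutes with prefixes, $\triangleright$, and $\parallel$; $\mathsf{dis}(\mathbf 0)=\mathbf 0$; $\mathsf{dis}(x\leftrightarrow y)=x\leftrightarrow y$; and if $\mathsf{dis}(P)=P_1\parallel\cdots\parallel P_n$ with $x\in\mathrm{fn}(P_i)$, $y\in\mathrm{fn}(P_j)$, then $\mathsf{dis}((\nu xy)P)$ is $(\nu xy)(P_i\parallel P_j)$ in parallel with all $P_k$, $k\ne i,j$. **Packing.** Contexts with holes $\square$: $\mathrm{pack}^{\wp}_y(\cdot)=y().\square$, $\mathrm{pack}^{\wp}_y(\Gamma,z:A)=y(z).\mathrm{pack}^{\wp}_y(\Gamma)$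 for $y$ not in $\Gamma,z$; $\mathrm{pack}^{\otimes}_x(\emptyset)=x[].\mathbf 0$, $\mathrm{pack}^{\otimes}_x(\mathcal G\parallel\Gamma)=x[y].(\mathrm{pack}^{\otimes}_x(\mathcal G)\parallel\mathrm{pack}^{\wp}_y(\Gamma))$ for $x,y$ fresh. For $\mathcal G=\Gamma_1\parallel\cdots\parallel\Gamma_n$, $x\notin\mathrm{fn}(P)$ and $\mathsf{dis}(P)=P_1\parallel\cdots\parallel P_n$, with $P_i$ the component corresponding to $\Gamma_i$, $\mathrm{pack}_x(\vdash P::\mathcal G)$ is $\mathrm{pack}^{\otimes}_x(\mathcal G)$ with its $n$ holes filled by $P_1,\ldots,P_n$. Here the judgement inside $\mathrm{pack}_x(\cdot)$ is used as a syntactic index. (For parallel composition and $\otimes$ in CP the two components are as given by the context.) -}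

module Defs where

open import Data.List using (List; []; _∷_; [_]; _++_; map; filter; concat; length)
open import Data.List.Membership.DecPropositional using (_∈?_)
open import Data.List.Membership.Propositional using (_∈_; _∉_)
open import Data.List.Relation.Binary.BagAndSetEquality using (_∼[_]_; set)
open import Data.List.Relation.Binary.Permutation.Propositional using (_↭_; ↭-setoid)
import Data.List.Relation.Binary.Permutation.Setoid as SetoidPermutation
open import Data.List.Relation.Unary.All using (All)
open import Data.List.Relation.Unary.Unique.Propositional using (Unique)
open import Data.Nat using (ℕ; zero; suc; _+_; _∸_; _≟_; _≤?_)
open import Data.Product using (_×_; _,_; proj₁; proj₂; map₁; map₂)
open import Data.Sum using (_⊎_)
open import Data.Vec using (Vec; []; _∷_; toList; fromList)
open import Data.Vec.Relation.Binary.Pointwise.Inductive using (Pointwise)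
open import Function using (_∘_)
open import Relation.Binary.PropositionalEquality using (_≢_)
open import Relation.Nullary using (Dec; yes; no)
open import Relation.Nullary.Decidable using (¬?; _⊎-dec_)

-- Syntax is nameless, so terms are identified up to renaming of bound names
-- and bound type variables.  Names and type variables are de Bruijn indices:
-- under k binders the indices 0 … k-1 are the bound ones and k + i is what i
-- is outside.  The two supplies are separate: a binder of names does not shift
-- type variables, and conversely.

Name TVar : Set
Name = ℕ
TVar = ℕ

infixr 30 _⊗_ _⅋_ _⊕_ _&_
infix  40 ⁇_ ‼_
infix  50 _^⊥

data Type : Set where
  _⊗_ _⅋_ _⊕_ _&_ : Type → Type → Type
  𝟏 ⊥             : Type
  var covar       : TVar → Type
  ∃∙ ∀∙           : Type → Type
  ⁇_ ‼_           : Type → Type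

_^⊥ : Type → Type
(A ⊗ B) ^⊥   = (A ^⊥) ⅋ (B ^⊥)
(A ⅋ B) ^⊥   = (A ^⊥) ⊗ (B ^⊥)
(A ⊕ B) ^⊥   = (A ^⊥) & (B ^⊥)
(A & B) ^⊥   = (A ^⊥) ⊕ (B ^⊥)
𝟏 ^⊥         = ⊥
⊥ ^⊥         = 𝟏
(var X) ^⊥   = covar X
(covar X) ^⊥ = var X
(∃∙ A) ^⊥    = ∀∙ (A ^⊥)
(∀∙ A) ^⊥    = ∃∙ (A ^⊥)
(⁇ A) ^⊥     = ‼ (A ^⊥)
(‼ A) ^⊥     = ⁇ (A ^⊥)

lift : (ℕ → ℕ) → ℕ → ℕ
lift ρ zero    = zero
lift ρ (suc i) = suc (ρ i)

lifts : ℕ → (ℕ → ℕ) → ℕ → ℕ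
lifts zero    ρ = ρ
lifts (suc k) ρ = lift (lifts k ρ)

renᵀ : (TVar → TVar) → Type → Type
renᵀ ρ (A ⊗ B)   = renᵀ ρ A ⊗ renᵀ ρ B
renᵀ ρ (A ⅋ B)   = renᵀ ρ A ⅋ renᵀ ρ B
renᵀ ρ (A ⊕ B)   = renᵀ ρ A ⊕ renᵀ ρ B
renᵀ ρ (A & B)   = renᵀ ρ A & renᵀ ρ B
renᵀ ρ 𝟏         = 𝟏
renᵀ ρ ⊥         = ⊥
renᵀ ρ (var X)   = var (ρ X)
renᵀ ρ (covar X) = covar (ρ X)
renᵀ ρ (∃∙ A)    = ∃∙ (renᵀ (lift ρ) A)
renᵀ ρ (∀∙ A)    = ∀∙ (renᵀ (lift ρ) A)
renᵀ ρ (⁇ A)     = ⁇ (renᵀ ρ A)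
renᵀ ρ (‼ A)     = ‼ (renᵀ ρ A)

liftˢ : (TVar → Type) → TVar → Type
liftˢ σ zero    = var zero
liftˢ σ (suc X) = renᵀ suc (σ X)

subᵀ : (TVar → Type) → Type → Type
subᵀ σ (A ⊗ B)   = subᵀ σ A ⊗ subᵀ σ B
subᵀ σ (A ⅋ B)   = subᵀ σ A ⅋ subᵀ σ B
subᵀ σ (A ⊕ B)   = subᵀ σ A ⊕ subᵀ σ B
subᵀ σ (A & B)   = subᵀ σ A & subᵀ σ B
subᵀ σ 𝟏         = 𝟏
subᵀ σ ⊥         = ⊥
subᵀ σ (var X)   = σ X
subᵀ σ (covar X) = σ X ^⊥
subᵀ σ (∃∙ A)    = ∃∙ (subᵀ (liftˢ σ) A)
subᵀ σ (∀∙ A)    = ∀∙ (subᵀ (liftˢ σ) A)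
subᵀ σ (⁇ A)     = ⁇ (subᵀ σ A)
subᵀ σ (‼ A)     = ‼ (subᵀ σ A)

single : Type → TVar → Type
single A zero    = A
single A (suc X) = var X

-- B ⟦ A ⟧ is B{A/X}, where X is the index 0 of B.
_⟦_⟧ : Type → Type → Type
B ⟦ A ⟧ = subᵀ (single A) B

data Prefix : Set where
  out   : Name → Prefix         -- x[y].
  inp   : Name → Prefix         -- x(y).
  close : Name → Prefix         -- x[].
  wait  : Name → Prefix         -- x().
  inl   : Name → Prefix         -- x[inl].
  inr   : Name → Prefix         -- x[inr].
  outᵀ  : Name → Type → Prefix  -- x[A].
  inpᵀ  : Name → Prefix         -- x(X).   (binds the type variable 0)
  serve : Name → Prefix         -- !x(y).
  use   : Name → Prefix         -- ?x[y].
  dup   : Name → Prefix         -- ?x[x₁,x₂].   (x₁ is 0 and x₂ is 1)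
  drop  : Name → Prefix         -- ?x[].

subject : Prefix → Name
subject (out x)    = x
subject (inp x)    = x
subject (close x)  = x
subject (wait x)   = x
subject (inl x)    = x
subject (inr x)    = x
subject (outᵀ x A) = x
subject (inpᵀ x)   = x
subject (serve x)  = x
subject (use x)    = x
subject (dup x)    = x
subject (drop x)   = x

-- The number of names a prefix binds in its continuation.
bound : Prefix → ℕ
bound (out x)    = 1
bound (inp x)    = 1
bound (close x)  = 0
bound (wait x)   = 0
bound (inl x)    = 0
bound (inr x)    = 0
bound (outᵀ x A) = 0
bound (inpᵀ x)   = 0
bound (serve x)  = 1
bound (use x)    = 1
bound (dup x)    = 2
bound (drop x)   = 0

infixr 20 _∙_
infixr 15 _∥_

data Proc : Set where
  _∙_     : Prefix → Proc → Proc
  _▷⟨_,_⟩ : Name → Proc → Proc → Proc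
  ν       : Proc → Proc                -- (νxy)P, with x the index 0 and y the index 1
  _∥_     : Proc → Proc → Proc
  𝟎       : Proc
  _↔_     : Name → Name → Proc

renᴾ : (Name → Name) → Prefix → Prefix
renᴾ ρ (out x)    = out (ρ x)
renᴾ ρ (inp x)    = inp (ρ x)
renᴾ ρ (close x)  = close (ρ x)
renᴾ ρ (wait x)   = wait (ρ x)
renᴾ ρ (inl x)    = inl (ρ x)
renᴾ ρ (inr x)    = inr (ρ x)
renᴾ ρ (outᵀ x A) = outᵀ (ρ x) A
renᴾ ρ (inpᵀ x)   = inpᵀ (ρ x)
renᴾ ρ (serve x)  = serve (ρ x)
renᴾ ρ (use x)    = use (ρ x)
renᴾ ρ (dup x)    = dup (ρ x)
renᴾ ρ (drop x)   = drop (ρ x)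

ren : (Name → Name) → Proc → Proc
ren ρ (π ∙ P)         = renᴾ ρ π ∙ ren (lifts (bound π) ρ) P
ren ρ (x ▷⟨ P , Q ⟩)  = ρ x ▷⟨ ren ρ P , ren ρ Q ⟩
ren ρ (ν P)           = ν (ren (lifts 2 ρ) P)
ren ρ (P ∥ Q)         = ren ρ P ∥ ren ρ Q
ren ρ 𝟎               = 𝟎
ren ρ (x ↔ y)         = ρ x ↔ ρ y

unbind : ℕ → List Name → List Name
unbind k xs = map (_∸ k) (filter (k ≤?_) xs)

fn : Proc → List Name
fn (π ∙ P)        = subject π ∷ unbind (bound π) (fn P)
fn (x ▷⟨ P , Q ⟩) = x ∷ fn P ++ fn Q
fn (ν P)          = unbind 2 (fn P)
fn (P ∥ Q)        = fn P ++ fn Q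
fn 𝟎              = []
fn (x ↔ y)        = x ∷ y ∷ []

-- Equality of processes when parallel composition is read modulo
-- associativity, commutativity and unit.
infix 4 _≅_

data _≅_ : Proc → Proc → Set where
  ≅-refl  : ∀ {P} → P ≅ P
  ≅-sym   : ∀ {P Q} → P ≅ Q → Q ≅ P
  ≅-trans : ∀ {P Q R} → P ≅ Q → Q ≅ R → P ≅ R
  ∥-assoc : ∀ {P Q R} → (P ∥ Q) ∥ R ≅ P ∥ (Q ∥ R)
  ∥-comm  : ∀ {P Q} → P ∥ Q ≅ Q ∥ P
  ∥-unit  : ∀ {P} → P ∥ 𝟎 ≅ P
  ∙-cong  : ∀ {π P Q} → P ≅ Q → π ∙ P ≅ π ∙ Q
  ▷-cong  : ∀ {x P P′ Q Q′} → P ≅ P′ → Q ≅ Q′ → x ▷⟨ P , Q ⟩ ≅ x ▷⟨ P′ , Q′ ⟩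
  ν-cong  : ∀ {P Q} → P ≅ Q → ν P ≅ ν Q
  ∥-cong  : ∀ {P P′ Q Q′} → P ≅ P′ → Q ≅ Q′ → P ∥ Q ≅ P′ ∥ Q′

-- Lists enumerate environments and hyperenvironments; typing is closed under
-- re-enumeration (exch below), and distinctness of names is a separate
-- predicate.
Env HyperEnv : Set
Env      = List (Name × Type)
HyperEnv = List Env

open SetoidPermutation (↭-setoid {A = Name × Type}) using () renaming (_↭_ to _≋_) public

names : Env → List Name
names = map proj₁

Distinct : HyperEnv → Set
Distinct 𝒢 = Unique (names (concat 𝒢))

infixl 35 _↑_ _⇑_

_↑_ : Env → ℕ → Env
Γ ↑ k = map (map₁ (k +_)) Γ

_⇑_ : HyperEnv → ℕ → HyperEnv
𝒢 ⇑ k = map (_↑ k) 𝒢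

_↑ᵀ : Env → Env
Γ ↑ᵀ = map (map₂ (renᵀ suc)) Γ

data WhyNot : Type → Set where
  whyNot : ∀ {A} → WhyNot (⁇ A)

variable
  x y     : Name
  A B     : Type
  P Q     : Proc
  Γ Δ     : Env
  𝒢 ℋ     : HyperEnv

-- In both systems the side conditions on names are those under which the
-- conclusion again has distinct names.  Γ ↑ᵀ in (∀) expresses that the bound
-- type variable is not free in Γ.

infix 3 ⊢_⦂_ ⊢CP_⦂_

data ⊢_⦂_ : Proc → HyperEnv → Set where
  exch : 𝒢 ≋ ℋ → ⊢ P ⦂ 𝒢 → ⊢ P ⦂ ℋ
  ax   : x ≢ y →
         ⊢ x ↔ y ⦂ [ (x , A ^⊥) ∷ (y , A) ∷ [] ]
  cut  : ⊢ P ⦂ ((0 , A) ∷ Γ ↑ 2) ∷ ((1 , A ^⊥) ∷ Δ ↑ 2) ∷ 𝒢 ⇑ 2 →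
         ⊢ ν P ⦂ (Γ ++ Δ) ∷ 𝒢
  mix  : Distinct (𝒢 ++ ℋ) →
         ⊢ P ⦂ 𝒢 → ⊢ Q ⦂ ℋ →
         ⊢ P ∥ Q ⦂ 𝒢 ++ ℋ
  mix₀ : ⊢ 𝟎 ⦂ []
  ⊗ʳ   : ⊢ P ⦂ ((0 , A) ∷ Γ ↑ 1) ∷ ((suc x , B) ∷ Δ ↑ 1) ∷ [] →
         ⊢ out x ∙ P ⦂ [ (x , A ⊗ B) ∷ Γ ++ Δ ]
  𝟏ʳ   : ⊢ P ⦂ [] →
         ⊢ close x ∙ P ⦂ [ [ x , 𝟏 ] ]
  ⅋ʳ   : ⊢ P ⦂ [ (0 , A) ∷ (suc x , B) ∷ Γ ↑ 1 ] →
         ⊢ inp x ∙ P ⦂ [ (x , A ⅋ B) ∷ Γ ]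
  ⊥ʳ   : x ∉ names Γ →
         ⊢ P ⦂ [ Γ ] →
         ⊢ wait x ∙ P ⦂ [ (x , ⊥) ∷ Γ ]
  ⊕₁ʳ  : ⊢ P ⦂ [ (x , A) ∷ Γ ] →
         ⊢ inl x ∙ P ⦂ [ (x , A ⊕ B) ∷ Γ ]
  ⊕₂ʳ  : ⊢ P ⦂ [ (x , B) ∷ Γ ] →
         ⊢ inr x ∙ P ⦂ [ (x , A ⊕ B) ∷ Γ ]
  &ʳ   : ⊢ P ⦂ [ (x , A) ∷ Γ ] → ⊢ Q ⦂ [ (x , B) ∷ Γ ] →
         ⊢ x ▷⟨ P , Q ⟩ ⦂ [ (x , A & B) ∷ Γ ]
  ‼ʳ   : x ∉ names Γ → All (WhyNot ∘ proj₂) Γ →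
         ⊢ P ⦂ [ (0 , A) ∷ Γ ↑ 1 ] →
         ⊢ serve x ∙ P ⦂ [ (x , ‼ A) ∷ Γ ]
  ⁇ʳ   : x ∉ names Γ →
         ⊢ P ⦂ [ (0 , A) ∷ Γ ↑ 1 ] →
         ⊢ use x ∙ P ⦂ [ (x , ⁇ A) ∷ Γ ]
  Wʳ   : x ∉ names Γ →
         ⊢ P ⦂ [ Γ ] →
         ⊢ drop x ∙ P ⦂ [ (x , ⁇ A) ∷ Γ ]
  Cʳ   : x ∉ names Γ →
         ⊢ P ⦂ [ (0 , ⁇ A) ∷ (1 , ⁇ A) ∷ Γ ↑ 2 ] →
         ⊢ dup x ∙ P ⦂ [ (x , ⁇ A) ∷ Γ ]
  ∃ʳ   : ⊢ P ⦂ [ (x , B ⟦ A ⟧) ∷ Γ ] →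
         ⊢ outᵀ x A ∙ P ⦂ [ (x , ∃∙ B) ∷ Γ ]
  ∀ʳ   : ⊢ P ⦂ [ (x , B) ∷ Γ ↑ᵀ ] →
         ⊢ inpᵀ x ∙ P ⦂ [ (x , ∀∙ B) ∷ Γ ]

-- The two components in (Cut) and (⊗) come in either order, since processes
-- are read modulo ≅ (conv).  No such rule is needed above, where mix and mix₀
-- already type any rearrangement of a parallel composition.

data ⊢CP_⦂_ : Proc → Env → Set where
  exch : Γ ↭ Δ → ⊢CP P ⦂ Γ → ⊢CP P ⦂ Δ
  conv : P ≅ Q → ⊢CP P ⦂ Γ → ⊢CP Q ⦂ Γ
  ax   : x ≢ y →
         ⊢CP x ↔ y ⦂ (x , A ^⊥) ∷ (y , A) ∷ []
  cut  : Unique (names (Γ ++ Δ)) →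
         ⊢CP P ⦂ (0 , A) ∷ Γ ↑ 2 → ⊢CP Q ⦂ (1 , A ^⊥) ∷ Δ ↑ 2 →
         ⊢CP ν (P ∥ Q) ⦂ Γ ++ Δ
  ⊗ʳ   : Unique (names ((x , A ⊗ B) ∷ Γ ++ Δ)) →
         ⊢CP P ⦂ (0 , A) ∷ Γ ↑ 1 → ⊢CP Q ⦂ (suc x , B) ∷ Δ ↑ 1 →
         ⊢CP out x ∙ (P ∥ Q) ⦂ (x , A ⊗ B) ∷ Γ ++ Δ
  𝟏ʳ   : ⊢CP close x ∙ 𝟎 ⦂ [ x , 𝟏 ]
  ⅋ʳ   : ⊢CP P ⦂ (0 , A) ∷ (suc x , B) ∷ Γ ↑ 1 →
         ⊢CP inp x ∙ P ⦂ (x , A ⅋ B) ∷ Γ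
  ⊥ʳ   : x ∉ names Γ →
         ⊢CP P ⦂ Γ →
         ⊢CP wait x ∙ P ⦂ (x , ⊥) ∷ Γ
  ⊕₁ʳ  : ⊢CP P ⦂ (x , A) ∷ Γ →
         ⊢CP inl x ∙ P ⦂ (x , A ⊕ B) ∷ Γ
  ⊕₂ʳ  : ⊢CP P ⦂ (x , B) ∷ Γ →
         ⊢CP inr x ∙ P ⦂ (x , A ⊕ B) ∷ Γ
  &ʳ   : ⊢CP P ⦂ (x , A) ∷ Γ → ⊢CP Q ⦂ (x , B) ∷ Γ →
         ⊢CP x ▷⟨ P , Q ⟩ ⦂ (x , A & B) ∷ Γ
  ‼ʳ   : x ∉ names Γ → All (WhyNot ∘ proj₂) Γ →
         ⊢CP P ⦂ (0 , A) ∷ Γ ↑ 1 →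
         ⊢CP serve x ∙ P ⦂ (x , ‼ A) ∷ Γ
  ⁇ʳ   : x ∉ names Γ →
         ⊢CP P ⦂ (0 , A) ∷ Γ ↑ 1 →
         ⊢CP use x ∙ P ⦂ (x , ⁇ A) ∷ Γ
  Wʳ   : x ∉ names Γ →
         ⊢CP P ⦂ Γ →
         ⊢CP drop x ∙ P ⦂ (x , ⁇ A) ∷ Γ
  Cʳ   : x ∉ names Γ →
         ⊢CP P ⦂ (0 , ⁇ A) ∷ (1 , ⁇ A) ∷ Γ ↑ 2 →
         ⊢CP dup x ∙ P ⦂ (x , ⁇ A) ∷ Γ
  ∃ʳ   : ⊢CP P ⦂ (x , B ⟦ A ⟧) ∷ Γ →
         ⊢CP outᵀ x A ∙ P ⦂ (x , ∃∙ B) ∷ Γ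
  ∀ʳ   : ⊢CP P ⦂ (x , B) ∷ Γ ↑ᵀ →
         ⊢CP inpᵀ x ∙ P ⦂ (x , ∀∙ B) ∷ Γ

Par : Env → Type
Par []            = ⊥
Par ((z , A) ∷ Γ) = A ⅋ Par Γ

⨂ : HyperEnv → Type
⨂ []      = 𝟏
⨂ (Γ ∷ 𝒢) = Par Γ ⊗ ⨂ 𝒢

par : List Proc → Proc
par []           = 𝟎
par (P ∷ [])     = P
par (P ∷ Q ∷ Ps) = P ∥ par (Q ∷ Ps)

Linked : Proc → Set
Linked P = 0 ∈ fn P ⊎ 1 ∈ fn P

linked? : ∀ P → Dec (Linked P)
linked? P = _∈?_ _≟_ 0 (fn P) ⊎-dec _∈?_ _≟_ 1 (fn P)

-- dis P is the list P₁ , … , Pₙ of parallel components of the disentangled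
-- process P₁ ∥ … ∥ Pₙ.  Under (νxy) exactly the components in which x or y is
-- free stay in its scope: these are Pᵢ and Pⱼ when x is free only in Pᵢ and y
-- only in Pⱼ, and in general this is the normal form of scope extrusion.  The
-- components that leave the scope are renamed by _∸ 2, which undoes the shift
-- past the two binders.
dis : Proc → List Proc
dis (π ∙ P)        = [ π ∙ par (dis P) ]
dis (x ▷⟨ P , Q ⟩) = [ x ▷⟨ par (dis P) , par (dis Q) ⟩ ]
dis (ν P)          = ν (par (filter linked? (dis P)))
                   ∷ map (ren (_∸ 2)) (filter (¬? ∘ linked?) (dis P))
dis (P ∥ Q)        = dis P ++ dis Q
dis 𝟎              = []
dis (x ↔ y)        = [ x ↔ y ]

capture : Name → Name → Name
capture z w with w ≟ z
... | yes _ = 0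
... | no  _ = suc w

-- The free name z of P becomes the name 0 bound by a prefix put before bind z P.
bind : Name → Proc → Proc
bind z = ren (capture z)

-- pack⅋ y Γ P and pack⊗ x 𝒢 Ps are the packing contexts with their holes
-- filled.  The holes lie under binders for the names of the environments, so
-- filling them captures free names of the components.

pack⅋ : Name → Env → Proc → Proc
pack⅋ y []            P = wait y ∙ P
pack⅋ y ((z , A) ∷ Γ) P = inp y ∙ bind z (pack⅋ y Γ P)

pack⊗ : Name → (𝒢 : HyperEnv) → Vec Proc (length 𝒢) → Proc
pack⊗ x []      []       = close x ∙ 𝟎
pack⊗ x (Γ ∷ 𝒢) (P ∷ Ps) =
  out x ∙ (ren suc (pack⊗ x 𝒢 Ps) ∥ pack⅋ 0 (Γ ↑ 1) (ren suc P))

Corresponds : Env → Proc → Set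
Corresponds Γ P = names Γ ∼[ set ] fn P

-- pack_x(⊢ P :: 𝒢), as a relation because it is partial: dis P must have as
-- many components as 𝒢 has environments, and these must be matched so that
-- each environment and its component have the same names.
data Pack (x : Name) (P : Proc) (𝒢 : HyperEnv) : Proc → Set where
  pack : (Ps : Vec Proc (length 𝒢)) →
         dis P ↭ toList Ps →
         Pointwise Corresponds (fromList 𝒢) Ps →
         Pack x P 𝒢 (pack⊗ x 𝒢 Ps)

-- Disentangling is sound and complete for typing.  If ⊢ P ⦂ 𝒢, then the parallel
-- components of P correspond to the environments of 𝒢 and each is typable in CP
-- with its environment: in (Cut), the premise has one component containing x and
-- another containing y, these two are cut in CP, and all others leave the scope of ν.
-- CP-typed components are assembled by the packing prefixes.  Conversely, a CP
-- derivation is a πLL derivation of a single environment, as πLL typing is invariant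
-- under ≅.  Inverting the rules for the packing prefixes in πLL, where parallel
-- composition only arises from mix, types every component; composing these types
-- par (dis P), and scope extrusion can be undone without changing the type.

module Submission where

open import Defs
open import Data.Bool using (true; false)
open import Data.Empty using (⊥-elim)
open import Data.List using (List; []; _∷_; [_]; _++_; map; filter; concat; length)
open import Data.List.Membership.Propositional using (_∈_; _∉_)
open import Data.List.Membership.Propositional.Properties
  using (∈-map⁺; ∈-map⁻; ∈-filter⁺; ∈-map∘filter⁻; ∈-++⁺ˡ; ∈-++⁺ʳ)
open import Data.List.Properties
  using (map-++; concat-map; concat-++; ++-identityʳ; ++-assoc; filter-accept; filter-reject; filter-all; filter-none)
open import Data.List.Relation.Binary.BagAndSetEquality
  using (_∼[_]_; [_]-Equality; set; ∷-cong; ++-cong; ++-idempotent)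
open import Data.List.Relation.Binary.Permutation.Propositional
  using (_↭_; ↭-refl; ↭-sym; ↭-trans; ↭-prep; ↭-swap; ↭-reflexive; ↭-setoid; ↭⇒↭ₛ)
import Data.List.Relation.Binary.Permutation.Propositional as ↭
import Data.List.Relation.Binary.Permutation.Propositional.Properties as Perm
import Data.List.Relation.Binary.Permutation.Setoid as SetoidPermutation
import Data.List.Relation.Binary.Permutation.Setoid.Properties as SetoidPermutationProperties
import Data.List.Relation.Binary.Pointwise as Pointwise
open import Data.List.Relation.Binary.Pointwise using ([]; _∷_) renaming (Pointwise to Pointwiseᴸ)
open import Data.List.Relation.Unary.All as All using (All; []; _∷_)
import Data.List.Relation.Unary.All.Properties as All
open import Data.List.Relation.Unary.AllPairs using ([]; _∷_)
open import Data.List.Relation.Unary.Any using (here; there)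
open import Data.List.Relation.Unary.Unique.Propositional using (Unique)
import Data.List.Relation.Unary.Unique.Propositional.Properties as Unique
open import Data.Nat using (zero; suc; _+_; _∸_; _≤?_; _≟_)
open import Data.Nat.Properties using (+-cancelˡ-≡; m≤m+n; m+n∸m≡n; m+[n∸m]≡n)
open import Data.Product using (_×_; _,_; ∃-syntax; proj₁; map₁)
open import Data.Sum using (_⊎_; inj₁; inj₂)
open import Data.Vec using ([]; _∷_; toList; fromList)
open import Data.Vec.Relation.Binary.Pointwise.Inductive as PointwiseV using (Pointwise; []; _∷_)
open import Function using (_∘_; id)
open import Function.Bundles using (_⇔_; mk⇔; module Equivalence)
open import Relation.Binary using (Setoid)
open import Relation.Binary.PropositionalEquality
  using (_≡_; _≢_; refl; sym; trans; cong; cong₂; subst; setoid; module ≡-Reasoning)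
open import Relation.Nullary using (Dec; does; yes; no; ¬_)
open import Relation.Nullary.Decidable using (¬?)

open Equivalence using (to; from)

module ≋ where
  open SetoidPermutation (↭-setoid {A = Name × Type}) public hiding (↭-setoid)
  open SetoidPermutationProperties (↭-setoid {A = Name × Type}) public

module ∼ = Setoid ([ set ]-Equality Name)

private
  variable
    𝒦   : HyperEnv
    ρ σ : Name → Name

-- Distinctness under re-enumeration

Unique-resp-↭ : ∀ {xs ys : List Name} → xs ↭ ys → Unique xs → Unique ys
Unique-resp-↭ p = SetoidPermutationProperties.Unique-resp-↭ (setoid Name) (↭⇒↭ₛ p)

concat-≋ : 𝒢 ≋ ℋ → concat 𝒢 ↭ concat ℋ
concat-≋ (≋.refl [])       = ↭-refl
concat-≋ (≋.refl (p ∷ ps)) = Perm.++⁺ p (concat-≋ (≋.refl ps))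
concat-≋ (≋.prep p ps)     = Perm.++⁺ p (concat-≋ ps)
concat-≋ (≋.swap {x = Γ} {y = Δ} p q ps) =
  ↭-trans (Perm.shifts Γ Δ) (Perm.++⁺ q (Perm.++⁺ p (concat-≋ ps)))
concat-≋ (≋.trans ps qs)   = ↭-trans (concat-≋ ps) (concat-≋ qs)

Distinct-resp-≋ : 𝒢 ≋ ℋ → Distinct 𝒢 → Distinct ℋ
Distinct-resp-≋ p = Unique-resp-↭ (Perm.map⁺ proj₁ (concat-≋ p))

-- Renaming

names-++ : ∀ Γ Δ → names (Γ ++ Δ) ≡ names Γ ++ names Δ
names-++ = map-++ proj₁

renᴱ : (Name → Name) → Env → Env
renᴱ ρ = map (map₁ ρ)

renᴴ : (Name → Name) → HyperEnv → HyperEnv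
renᴴ ρ = map (renᴱ ρ)

-- A general commuting square of renamings, so that each law for lifting past a shift becomes an
-- instance whose pointwise equation holds by computation.
renᴱ-fuse : {τ υ : Name → Name} → (∀ z → σ (ρ z) ≡ τ (υ z)) → ∀ Γ →
            renᴱ σ (renᴱ ρ Γ) ≡ renᴱ τ (renᴱ υ Γ)
renᴱ-fuse eq []            = refl
renᴱ-fuse eq ((z , A) ∷ Γ) = cong₂ _∷_ (cong (_, A) (eq z)) (renᴱ-fuse eq Γ)

renᴱ-lift : ∀ Γ → renᴱ (lift ρ) (Γ ↑ 1) ≡ renᴱ ρ Γ ↑ 1
renᴱ-lift = renᴱ-fuse (λ _ → refl)

renᴱ-lift₂ : ∀ Γ → renᴱ (lifts 2 ρ) (Γ ↑ 2) ≡ renᴱ ρ Γ ↑ 2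
renᴱ-lift₂ = renᴱ-fuse (λ _ → refl)

renᴴ-lift₂ : ∀ 𝒢 → renᴴ (lifts 2 ρ) (𝒢 ⇑ 2) ≡ renᴴ ρ 𝒢 ⇑ 2
renᴴ-lift₂ []      = refl
renᴴ-lift₂ (Γ ∷ 𝒢) = cong₂ _∷_ (renᴱ-lift₂ Γ) (renᴴ-lift₂ 𝒢)

renᴱ-↑ᵀ : ∀ Γ → renᴱ ρ (Γ ↑ᵀ) ≡ renᴱ ρ Γ ↑ᵀ
renᴱ-↑ᵀ []      = refl
renᴱ-↑ᵀ (_ ∷ Γ) = cong (_ ∷_) (renᴱ-↑ᵀ Γ)

renᴴ-≋ : 𝒢 ≋ ℋ → renᴴ ρ 𝒢 ≋ renᴴ ρ ℋ
renᴴ-≋ = ≋.map⁺ ↭-setoid (Perm.map⁺ _)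

-- Renamings need not be injective everywhere (_∸ 2 is not); it suffices that
-- they have a left inverse on the names in use.
data Fixed (σ ρ : Name → Name) (z : Name) : Set where
  fixed : σ (ρ z) ≡ z → Fixed σ ρ z

Inverse : (Name → Name) → (Name → Name) → Env → Set
Inverse σ ρ = All (Fixed σ ρ ∘ proj₁)

Fixed-lift : Fixed σ ρ x → Fixed (lift σ) (lift ρ) (suc x)
Fixed-lift (fixed i) = fixed (cong suc i)

Inverse-lift : Inverse σ ρ Γ → Inverse (lift σ) (lift ρ) (Γ ↑ 1)
Inverse-lift = All.map⁺ ∘ All.map Fixed-lift

Inverse-lift₂ : Inverse σ ρ Γ → Inverse (lifts 2 σ) (lifts 2 ρ) (Γ ↑ 2)
Inverse-lift₂ = All.map⁺ ∘ All.map (Fixed-lift ∘ Fixed-lift)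

Fixed-injective : Fixed σ ρ x → Fixed σ ρ y → ρ x ≡ ρ y → x ≡ y
Fixed-injective {σ = σ} (fixed i) (fixed j) eq = trans (sym i) (trans (cong σ eq) j)

renᴱ-∉ : Fixed σ ρ x → Inverse σ ρ Γ → x ∉ names Γ → ρ x ∉ names (renᴱ ρ Γ)
renᴱ-∉ i (j ∷ is) x∉ (here eq) = x∉ (here (Fixed-injective i j eq))
renᴱ-∉ i (_ ∷ is) x∉ (there m) = renᴱ-∉ i is (x∉ ∘ there) m

renᴱ-Unique : Inverse σ ρ Γ → Unique (names Γ) → Unique (names (renᴱ ρ Γ))
renᴱ-Unique []       []       = []
renᴱ-Unique (i ∷ is) (x∉ ∷ u) =
  All.¬Any⇒All¬ _ (renᴱ-∉ i is (All.All¬⇒¬Any x∉)) ∷ renᴱ-Unique is u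

renᴴ-Distinct : All (Inverse σ ρ) 𝒢 → Distinct 𝒢 → Distinct (renᴴ ρ 𝒢)
renᴴ-Distinct {𝒢 = 𝒢} is u =
  subst (Unique ∘ names) (sym (concat-map 𝒢)) (renᴱ-Unique (All.concat⁺ is) u)

⊢-resp-≡ : 𝒢 ≡ ℋ → ⊢ P ⦂ 𝒢 → ⊢ P ⦂ ℋ
⊢-resp-≡ refl d = d

-- The left inverse makes `ρ` injective on the names in use, which preserves the side conditions.
-- Under a binder both renamings are lifted: they fix the bound names and stay inverse on the
-- shifted ones.
ren-⊢ : All (Inverse σ ρ) 𝒢 → ⊢ P ⦂ 𝒢 → ⊢ ren ρ P ⦂ renᴴ ρ 𝒢
ren-⊢ is (exch p d) =
  exch (renᴴ-≋ p) (ren-⊢ (≋.All-resp-↭ (λ q → Perm.All-resp-↭ q) (≋.↭-sym p) is) d)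
ren-⊢ ((i ∷ j ∷ []) ∷ []) (ax x≢y) = ax (x≢y ∘ Fixed-injective i j)
ren-⊢ {ρ = ρ} (i ∷ is) (cut {Γ = Γ} {Δ = Δ} {𝒢 = 𝒢} d)
  rewrite map-++ (map₁ ρ) Γ Δ with All.++⁻ Γ i
... | i₁ , i₂ = cut (⊢-resp-≡ (cong₂ _∷_ (cong (_ ∷_) (renᴱ-lift₂ Γ))
                      (cong₂ _∷_ (cong (_ ∷_) (renᴱ-lift₂ Δ)) (renᴴ-lift₂ 𝒢)))
                      (ren-⊢ ((fixed refl ∷ Inverse-lift₂ i₁) ∷ (fixed refl ∷ Inverse-lift₂ i₂)
                             ∷ All.map⁺ (All.map Inverse-lift₂ is)) d))
ren-⊢ {ρ = ρ} is (mix {𝒢 = 𝒢} {ℋ = ℋ} u d e)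
  with renᴴ-Distinct is u | All.++⁻ 𝒢 is
... | u′ | is₁ , is₂ rewrite map-++ (renᴱ ρ) 𝒢 ℋ = mix u′ (ren-⊢ is₁ d) (ren-⊢ is₂ e)
ren-⊢ is mix₀ = mix₀
ren-⊢ {ρ = ρ} ((i ∷ is) ∷ []) (⊗ʳ {Γ = Γ} {Δ = Δ} d)
  rewrite map-++ (map₁ ρ) Γ Δ with All.++⁻ Γ is
... | i₁ , i₂ = ⊗ʳ (⊢-resp-≡ (cong₂ (λ Γ Δ → (_ ∷ Γ) ∷ (_ ∷ Δ) ∷ []) (renᴱ-lift Γ) (renᴱ-lift Δ))
                    (ren-⊢ ((fixed refl ∷ Inverse-lift i₁) ∷ (Fixed-lift i ∷ Inverse-lift i₂) ∷ []) d))
ren-⊢ {σ = σ} is (𝟏ʳ d) = 𝟏ʳ (ren-⊢ {σ = σ} [] d)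
ren-⊢ ((i ∷ is) ∷ []) (⅋ʳ {Γ = Γ} d) =
  ⅋ʳ (subst (λ Γ → ⊢ _ ⦂ [ _ ∷ _ ∷ Γ ]) (renᴱ-lift Γ)
     (ren-⊢ ((fixed refl ∷ Fixed-lift i ∷ Inverse-lift is) ∷ []) d))
ren-⊢ ((i ∷ is) ∷ []) (⊥ʳ x∉ d) = ⊥ʳ (renᴱ-∉ i is x∉) (ren-⊢ (is ∷ []) d)
ren-⊢ ((i ∷ is) ∷ []) (⊕₁ʳ d) = ⊕₁ʳ (ren-⊢ ((i ∷ is) ∷ []) d)
ren-⊢ ((i ∷ is) ∷ []) (⊕₂ʳ d) = ⊕₂ʳ (ren-⊢ ((i ∷ is) ∷ []) d)
ren-⊢ ((i ∷ is) ∷ []) (&ʳ d e) = &ʳ (ren-⊢ ((i ∷ is) ∷ []) d) (ren-⊢ ((i ∷ is) ∷ []) e)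
ren-⊢ ((i ∷ is) ∷ []) (‼ʳ {Γ = Γ} x∉ w d) =
  ‼ʳ (renᴱ-∉ i is x∉) (All.map⁺ w)
     (subst (λ Γ → ⊢ _ ⦂ [ _ ∷ Γ ]) (renᴱ-lift Γ) (ren-⊢ ((fixed refl ∷ Inverse-lift is) ∷ []) d))
ren-⊢ ((i ∷ is) ∷ []) (⁇ʳ {Γ = Γ} x∉ d) =
  ⁇ʳ (renᴱ-∉ i is x∉)
     (subst (λ Γ → ⊢ _ ⦂ [ _ ∷ Γ ]) (renᴱ-lift Γ) (ren-⊢ ((fixed refl ∷ Inverse-lift is) ∷ []) d))
ren-⊢ ((i ∷ is) ∷ []) (Wʳ x∉ d) = Wʳ (renᴱ-∉ i is x∉) (ren-⊢ (is ∷ []) d)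
ren-⊢ ((i ∷ is) ∷ []) (Cʳ {Γ = Γ} x∉ d) =
  Cʳ (renᴱ-∉ i is x∉)
     (subst (λ Γ → ⊢ _ ⦂ [ _ ∷ _ ∷ Γ ]) (renᴱ-lift₂ Γ)
     (ren-⊢ ((fixed refl ∷ fixed refl ∷ Inverse-lift₂ is) ∷ []) d))
ren-⊢ ((i ∷ is) ∷ []) (∃ʳ d) = ∃ʳ (ren-⊢ ((i ∷ is) ∷ []) d)
ren-⊢ ((i ∷ is) ∷ []) (∀ʳ {Γ = Γ} d) =
  ∀ʳ (subst (λ Γ → ⊢ _ ⦂ [ _ ∷ Γ ]) (renᴱ-↑ᵀ Γ) (ren-⊢ ((i ∷ All.map⁺ is) ∷ []) d))

⊢CP-resp-≡ : Γ ≡ Δ → ⊢CP P ⦂ Γ → ⊢CP P ⦂ Δ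
⊢CP-resp-≡ refl d = d

ren-≅ : P ≅ Q → ren ρ P ≅ ren ρ Q
ren-≅ ≅-refl        = ≅-refl
ren-≅ (≅-sym e)     = ≅-sym (ren-≅ e)
ren-≅ (≅-trans e f) = ≅-trans (ren-≅ e) (ren-≅ f)
ren-≅ ∥-assoc       = ∥-assoc
ren-≅ ∥-comm        = ∥-comm
ren-≅ ∥-unit        = ∥-unit
ren-≅ (∙-cong e)    = ∙-cong (ren-≅ e)
ren-≅ (▷-cong e f)  = ▷-cong (ren-≅ e) (ren-≅ f)
ren-≅ (ν-cong e)    = ν-cong (ren-≅ e)
ren-≅ (∥-cong e f)  = ∥-cong (ren-≅ e) (ren-≅ f)

ren-⊢CP : Inverse σ ρ Γ → ⊢CP P ⦂ Γ → ⊢CP ren ρ P ⦂ renᴱ ρ Γ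
ren-⊢CP is (exch p d) = exch (Perm.map⁺ _ p) (ren-⊢CP (Perm.All-resp-↭ (↭-sym p) is) d)
ren-⊢CP is (conv e d) = conv (ren-≅ e) (ren-⊢CP is d)
ren-⊢CP (i ∷ j ∷ []) (ax x≢y) = ax (x≢y ∘ Fixed-injective i j)
ren-⊢CP {ρ = ρ} is (cut {Γ = Γ} {Δ = Δ} u d e) with renᴱ-Unique is u | All.++⁻ Γ is
... | u′ | is₁ , is₂ rewrite map-++ (map₁ ρ) Γ Δ =
  cut u′ (subst (λ Γ → ⊢CP _ ⦂ _ ∷ Γ) (renᴱ-lift₂ Γ) (ren-⊢CP (fixed refl ∷ Inverse-lift₂ is₁) d))
         (subst (λ Γ → ⊢CP _ ⦂ _ ∷ Γ) (renᴱ-lift₂ Δ) (ren-⊢CP (fixed refl ∷ Inverse-lift₂ is₂) e))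
ren-⊢CP {ρ = ρ} is′@(i ∷ is) (⊗ʳ {Γ = Γ} {Δ = Δ} u d e) with renᴱ-Unique is′ u | All.++⁻ Γ is
... | u′ | is₁ , is₂ rewrite map-++ (map₁ ρ) Γ Δ =
  ⊗ʳ u′ (subst (λ Γ → ⊢CP _ ⦂ _ ∷ Γ) (renᴱ-lift Γ) (ren-⊢CP (fixed refl ∷ Inverse-lift is₁) d))
        (subst (λ Γ → ⊢CP _ ⦂ _ ∷ Γ) (renᴱ-lift Δ) (ren-⊢CP (Fixed-lift i ∷ Inverse-lift is₂) e))
ren-⊢CP is 𝟏ʳ = 𝟏ʳ
ren-⊢CP (i ∷ is) (⅋ʳ {Γ = Γ} d) =
  ⅋ʳ (subst (λ Γ → ⊢CP _ ⦂ _ ∷ _ ∷ Γ) (renᴱ-lift Γ)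
     (ren-⊢CP (fixed refl ∷ Fixed-lift i ∷ Inverse-lift is) d))
ren-⊢CP (i ∷ is) (⊥ʳ x∉ d) = ⊥ʳ (renᴱ-∉ i is x∉) (ren-⊢CP is d)
ren-⊢CP (i ∷ is) (⊕₁ʳ d) = ⊕₁ʳ (ren-⊢CP (i ∷ is) d)
ren-⊢CP (i ∷ is) (⊕₂ʳ d) = ⊕₂ʳ (ren-⊢CP (i ∷ is) d)
ren-⊢CP (i ∷ is) (&ʳ d e) = &ʳ (ren-⊢CP (i ∷ is) d) (ren-⊢CP (i ∷ is) e)
ren-⊢CP (i ∷ is) (‼ʳ {Γ = Γ} x∉ w d) =
  ‼ʳ (renᴱ-∉ i is x∉) (All.map⁺ w)
     (subst (λ Γ → ⊢CP _ ⦂ _ ∷ Γ) (renᴱ-lift Γ) (ren-⊢CP (fixed refl ∷ Inverse-lift is) d))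
ren-⊢CP (i ∷ is) (⁇ʳ {Γ = Γ} x∉ d) =
  ⁇ʳ (renᴱ-∉ i is x∉)
     (subst (λ Γ → ⊢CP _ ⦂ _ ∷ Γ) (renᴱ-lift Γ) (ren-⊢CP (fixed refl ∷ Inverse-lift is) d))
ren-⊢CP (i ∷ is) (Wʳ x∉ d) = Wʳ (renᴱ-∉ i is x∉) (ren-⊢CP is d)
ren-⊢CP (i ∷ is) (Cʳ {Γ = Γ} x∉ d) =
  Cʳ (renᴱ-∉ i is x∉)
     (subst (λ Γ → ⊢CP _ ⦂ _ ∷ _ ∷ Γ) (renᴱ-lift₂ Γ)
     (ren-⊢CP (fixed refl ∷ fixed refl ∷ Inverse-lift₂ is) d))
ren-⊢CP (i ∷ is) (∃ʳ d) = ∃ʳ (ren-⊢CP (i ∷ is) d)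
ren-⊢CP (i ∷ is) (∀ʳ {Γ = Γ} d) =
  ∀ʳ (subst (λ Γ → ⊢CP _ ⦂ _ ∷ Γ) (renᴱ-↑ᵀ Γ) (ren-⊢CP (i ∷ All.map⁺ is) d))

-- Distinctness and free names

Unique-++⁻ʳ : ∀ (xs : List Name) {ys} → Unique (xs ++ ys) → Unique ys
Unique-++⁻ʳ []       u       = u
Unique-++⁻ʳ (_ ∷ xs) (_ ∷ u) = Unique-++⁻ʳ xs u

Distinct-++⁻ʳ : ∀ 𝒢 → Distinct (𝒢 ++ ℋ) → Distinct ℋ
Distinct-++⁻ʳ {ℋ = ℋ} 𝒢 u = Unique-++⁻ʳ (names (concat 𝒢))
  (subst Unique (trans (cong names (sym (concat-++ 𝒢 ℋ))) (names-++ (concat 𝒢) (concat ℋ))) u)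

Distinct-++⁻ˡ : ∀ 𝒢 → Distinct (𝒢 ++ ℋ) → Distinct 𝒢
Distinct-++⁻ˡ {ℋ = ℋ} 𝒢 u = Distinct-++⁻ʳ {ℋ = 𝒢} ℋ (Distinct-resp-≋ (≋.++-comm 𝒢 ℋ) u)

names-↑ : ∀ k Γ → names (Γ ↑ k) ≡ map (k +_) (names Γ)
names-↑ k []      = refl
names-↑ k (_ ∷ Γ) = cong (_ ∷_) (names-↑ k Γ)

names-↑ᵀ : ∀ Γ → names (Γ ↑ᵀ) ≡ names Γ
names-↑ᵀ []      = refl
names-↑ᵀ (_ ∷ Γ) = cong (_ ∷_) (names-↑ᵀ Γ)

Unique-↑⁻ : ∀ k Γ → Unique (names (Γ ↑ k)) → Unique (names Γ)
Unique-↑⁻ k Γ u = Unique.map⁻ (subst Unique (names-↑ k Γ) u)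

Unique-↑⁺ : ∀ k Γ → Unique (names Γ) → Unique (names (Γ ↑ k))
Unique-↑⁺ k Γ u = subst Unique (sym (names-↑ k Γ)) (Unique.map⁺ (+-cancelˡ-≡ k _ _) u)

[-]-Unique : Distinct [ Γ ] → Unique (names Γ)
[-]-Unique {Γ = Γ} = subst (Unique ∘ names) (++-identityʳ Γ)

[-]-Distinct : Unique (names Γ) → Distinct [ Γ ]
[-]-Distinct {Γ = Γ} = subst (Unique ∘ names) (sym (++-identityʳ Γ))

-- The premise of (Cut) for k = 2, and of (⊗) for k = 1.
concat-split : ∀ k (a b : Name × Type) Γ Δ 𝒢 →
  concat ((a ∷ Γ ↑ k) ∷ (b ∷ Δ ↑ k) ∷ 𝒢 ⇑ k) ↭ a ∷ b ∷ concat ((Γ ++ Δ) ∷ 𝒢) ↑ k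
concat-split k a b Γ Δ 𝒢 = ↭-prep a (↭-trans (Perm.shift b (Γ ↑ k) _) (↭-prep b (↭-reflexive (sym (
  begin
    ((Γ ++ Δ) ++ concat 𝒢) ↑ k             ≡⟨ map-++ _ (Γ ++ Δ) (concat 𝒢) ⟩
    (Γ ++ Δ) ↑ k ++ concat 𝒢 ↑ k           ≡⟨ cong₂ _++_ (map-++ _ Γ Δ) (sym (concat-map 𝒢)) ⟩
    (Γ ↑ k ++ Δ ↑ k) ++ concat (𝒢 ⇑ k)     ≡⟨ ++-assoc (Γ ↑ k) (Δ ↑ k) _ ⟩
    Γ ↑ k ++ Δ ↑ k ++ concat (𝒢 ⇑ k)       ∎)))))
  where open ≡-Reasoning

Distinct-cut⁻ : Distinct (((0 , A) ∷ Γ ↑ 2) ∷ ((1 , B) ∷ Δ ↑ 2) ∷ 𝒢 ⇑ 2) → Distinct ((Γ ++ Δ) ∷ 𝒢)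
Distinct-cut⁻ {A = A} {Γ = Γ} {B = B} {Δ = Δ} {𝒢 = 𝒢} u
  with Unique-resp-↭ (Perm.map⁺ proj₁ (concat-split 2 (0 , A) (1 , B) Γ Δ 𝒢)) u
... | _ ∷ _ ∷ u = Unique-↑⁻ 2 (concat ((Γ ++ Δ) ∷ 𝒢)) u

0∉↑1 : ∀ Γ → 0 ∉ names (Γ ↑ 1)
0∉↑1 (_ ∷ Γ) (there m) = 0∉↑1 Γ m

0∉↑2 : ∀ Γ → 0 ∉ names (Γ ↑ 2)
0∉↑2 (_ ∷ Γ) (there m) = 0∉↑2 Γ m

1∉↑2 : ∀ Γ → 1 ∉ names (Γ ↑ 2)
1∉↑2 (_ ∷ Γ) (there m) = 1∉↑2 Γ m

∉-∷ : {xs : List Name} → x ≢ y → x ∉ xs → x ∉ y ∷ xs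
∉-∷ x≢y x∉ (here eq) = x≢y eq
∉-∷ x≢y x∉ (there m) = x∉ m

Unique-∷ : {xs : List Name} → x ∉ xs → Unique xs → Unique (x ∷ xs)
Unique-∷ x∉ u = All.¬Any⇒All¬ _ x∉ ∷ u

Distinct-cut⁺ : Distinct ((Γ ++ Δ) ∷ 𝒢) → Distinct (((0 , A) ∷ Γ ↑ 2) ∷ ((1 , B) ∷ Δ ↑ 2) ∷ 𝒢 ⇑ 2)
Distinct-cut⁺ {Γ = Γ} {Δ = Δ} {𝒢 = 𝒢} {A = A} {B = B} u =
  Unique-resp-↭ (Perm.map⁺ proj₁ (↭-sym (concat-split 2 (0 , A) (1 , B) Γ Δ 𝒢)))
    (Unique-∷ (∉-∷ (λ ()) (0∉↑2 Θ)) (Unique-∷ (1∉↑2 Θ) (Unique-↑⁺ 2 Θ u)))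
  where Θ = concat ((Γ ++ Δ) ∷ 𝒢)

Distinct-⊗⁻ : Distinct (((0 , A) ∷ Γ ↑ 1) ∷ ((suc x , B) ∷ Δ ↑ 1) ∷ []) → Unique (x ∷ names (Γ ++ Δ))
Distinct-⊗⁻ {A = A} {Γ = Γ} {x = x} {B = B} {Δ = Δ} u
  with Unique-resp-↭ (Perm.map⁺ proj₁ (concat-split 1 (0 , A) (suc x , B) Γ Δ [])) u
... | _ ∷ u = [-]-Unique {Γ = (x , B) ∷ Γ ++ Δ} (Unique-↑⁻ 1 ((x , B) ∷ concat [ Γ ++ Δ ]) u)

Distinct-⊗⁺ : Unique (x ∷ names (Γ ++ Δ)) → Distinct (((0 , A) ∷ Γ ↑ 1) ∷ ((suc x , B) ∷ Δ ↑ 1) ∷ [])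
Distinct-⊗⁺ {x = x} {Γ = Γ} {Δ = Δ} {A = A} {B = B} u =
  Unique-resp-↭ (Perm.map⁺ proj₁ (↭-sym (concat-split 1 (0 , A) (suc x , B) Γ Δ [])))
    (Unique-∷ (∉-∷ (λ ()) (0∉↑1 (concat [ Γ ++ Δ ])))
      (Unique-↑⁺ 1 ((x , B) ∷ concat [ Γ ++ Δ ]) ([-]-Distinct {Γ = (x , B) ∷ Γ ++ Δ} u)))

-- Most rules inherit distinctness by dropping the bound names of the premise and unshifting the
-- rest; side conditions supply it where separate names are brought together. It justifies the new
-- mixes built from inverted derivations.
⊢-Distinct : ⊢ P ⦂ 𝒢 → Distinct 𝒢
⊢-Unique : ⊢ P ⦂ [ Γ ] → Unique (names Γ)
⊢-Distinct (exch p d)   = Distinct-resp-≋ p (⊢-Distinct d)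
⊢-Distinct (ax x≢y)     = (x≢y ∷ []) ∷ [] ∷ []
⊢-Distinct (cut {A = A} {Γ = Γ} {Δ = Δ} {𝒢 = 𝒢} d) =
  Distinct-cut⁻ {A = A} {Γ = Γ} {B = A ^⊥} {Δ = Δ} {𝒢 = 𝒢} (⊢-Distinct d)
⊢-Distinct (mix u _ _)  = u
⊢-Distinct mix₀         = []
⊢-Distinct (⊗ʳ {A = A} {Γ = Γ} {x = x} {B = B} {Δ = Δ} d) =
  -- Only names count here, so `B` stands in for the type of `x` in the conclusion; `⊥` does so in
  -- later cases.
  [-]-Distinct {Γ = (x , B) ∷ Γ ++ Δ} (Distinct-⊗⁻ {A = A} {Γ = Γ} {B = B} {Δ = Δ} (⊢-Distinct d))
⊢-Distinct (𝟏ʳ d)       = [] ∷ []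
⊢-Distinct (⅋ʳ {x = x} {B = B} {Γ = Γ} d) with _ ∷ u ← ⊢-Unique d =
  [-]-Distinct {Γ = (x , B) ∷ Γ} (Unique-↑⁻ 1 ((x , B) ∷ Γ) u)
⊢-Distinct (⊥ʳ {x = x} {Γ = Γ} x∉ d)  = [-]-Distinct {Γ = (x , ⊥) ∷ Γ} (Unique-∷ x∉ (⊢-Unique d))
⊢-Distinct (⊕₁ʳ d)      = ⊢-Distinct d
⊢-Distinct (⊕₂ʳ d)      = ⊢-Distinct d
⊢-Distinct (&ʳ d e)     = ⊢-Distinct d
⊢-Distinct (‼ʳ {x = x} {Γ = Γ} x∉ w d) with _ ∷ u ← ⊢-Unique d =
  [-]-Distinct {Γ = (x , ⊥) ∷ Γ} (Unique-∷ x∉ (Unique-↑⁻ 1 Γ u))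
⊢-Distinct (⁇ʳ {x = x} {Γ = Γ} x∉ d) with _ ∷ u ← ⊢-Unique d =
  [-]-Distinct {Γ = (x , ⊥) ∷ Γ} (Unique-∷ x∉ (Unique-↑⁻ 1 Γ u))
⊢-Distinct (Wʳ {x = x} {Γ = Γ} x∉ d)  = [-]-Distinct {Γ = (x , ⊥) ∷ Γ} (Unique-∷ x∉ (⊢-Unique d))
⊢-Distinct (Cʳ {x = x} {Γ = Γ} x∉ d) with _ ∷ _ ∷ u ← ⊢-Unique d =
  [-]-Distinct {Γ = (x , ⊥) ∷ Γ} (Unique-∷ x∉ (Unique-↑⁻ 2 Γ u))
⊢-Distinct (∃ʳ d)       = ⊢-Distinct d
⊢-Distinct (∀ʳ {x = x} {Γ = Γ} d) =
  [-]-Distinct {Γ = (x , ⊥) ∷ Γ} (subst (Unique ∘ (x ∷_)) (names-↑ᵀ Γ) (⊢-Unique d))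
⊢-Unique {Γ = Γ} d = [-]-Unique {Γ = Γ} (⊢-Distinct d)

-- When a subject stays free in the continuation, `fn` lists it twice; as sets the two lists agree.
absorb : ∀ {xs : List Name} → x ∈ xs → xs ∼[ set ] x ∷ xs
absorb m {z} = mk⇔ there λ { (here refl) → m ; (there m) → m }

∈-unbind⁺ : ∀ k {xs z} → k + z ∈ xs → z ∈ unbind k xs
∈-unbind⁺ k {xs} {z} m =
  subst (_∈ unbind k xs) (m+n∸m≡n k z) (∈-map⁺ (_∸ k) (∈-filter⁺ (k ≤?_) {xs = xs} m (m≤m+n k z)))

∈-unbind⁻ : ∀ k {xs z} → z ∈ unbind k xs → k + z ∈ xs
∈-unbind⁻ k {xs} m with ∈-map∘filter⁻ (_∸ k) (k ≤?_) {xs = xs} m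
... | w , w∈ , refl , k≤w = subst (_∈ xs) (sym (m+[n∸m]≡n k≤w)) w∈

unbind-cong : ∀ k {xs ys} → xs ∼[ set ] ys → unbind k xs ∼[ set ] unbind k ys
unbind-cong k p {z} = mk⇔ (∈-unbind⁺ k ∘ to p ∘ ∈-unbind⁻ k) (∈-unbind⁺ k ∘ from p ∘ ∈-unbind⁻ k)

unbind-↑ : ∀ k Γ → names Γ ∼[ set ] unbind k (names (Γ ↑ k))
unbind-↑ k Γ {z} rewrite names-↑ k Γ =
  mk⇔ (∈-unbind⁺ k ∘ ∈-map⁺ (k +_)) λ m → unshift (∈-map⁻ (k +_) (∈-unbind⁻ k m))
  where
  unshift : (∃[ w ] w ∈ names Γ × k + z ≡ k + w) → z ∈ names Γ
  unshift (w , w∈ , eq) = subst (_∈ names Γ) (sym (+-cancelˡ-≡ k z w eq)) w∈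

-- A prefix that binds nothing still sends its free names through `unbind 0`, which does not compute
-- to the identity.
unbind-0 : ∀ {xs ys} → xs ∼[ set ] ys → xs ∼[ set ] unbind 0 ys
unbind-0 p {z} = mk⇔ (∈-unbind⁺ 0 ∘ to p) (from p ∘ ∈-unbind⁻ 0)

names-resp-∼ : Γ ↭ Δ → names Γ ∼[ set ] names Δ
names-resp-∼ p {z} = mk⇔ (Perm.∈-resp-↭ (Perm.map⁺ proj₁ p)) (Perm.∈-resp-↭ (Perm.map⁺ proj₁ (↭-sym p)))

names-[-] : ∀ Γ → names Γ ∼[ set ] names (concat [ Γ ])
names-[-] Γ = ∼.reflexive (cong names (sym (++-identityʳ Γ)))

prefix-names : ∀ Γ {ys} → names Γ ∼[ set ] ys → x ∷ names (concat [ Γ ]) ∼[ set ] x ∷ ys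
prefix-names Γ p = ∷-cong refl (∼.trans (∼.sym (names-[-] Γ)) p)

absorb-subject : ∀ {xs ys} → x ∷ xs ∼[ set ] ys → x ∷ xs ∼[ set ] x ∷ ys
absorb-subject p = ∼.trans (absorb (here refl)) (∷-cong refl p)

-- Set equality is the right notion, as `fn` repeats subjects and counts both branches of `&`. It
-- decides which components are linked under a ν and which side of a mix owns an environment.
⊢-names : ⊢ P ⦂ 𝒢 → names (concat 𝒢) ∼[ set ] fn P
⊢-Corresponds : ⊢ P ⦂ [ Γ ] → Corresponds Γ P
⊢-names (exch p d)   = ∼.trans (names-resp-∼ (↭-sym (concat-≋ p))) (⊢-names d)
⊢-names (ax x≢y)     = ∼.refl
⊢-names (cut {A = A} {Γ = Γ} {Δ = Δ} {𝒢 = 𝒢} d) = ∼.trans (unbind-↑ 2 (concat ((Γ ++ Δ) ∷ 𝒢)))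
  (unbind-cong 2 (∼.trans (names-resp-∼ (↭-sym (concat-split 2 (0 , A) (1 , A ^⊥) Γ Δ 𝒢))) (⊢-names d)))
⊢-names (mix {𝒢 = 𝒢} {ℋ = ℋ} u d e) =
  ∼.trans (∼.reflexive (trans (cong names (sym (concat-++ 𝒢 ℋ))) (names-++ (concat 𝒢) (concat ℋ))))
          (++-cong (⊢-names d) (⊢-names e))
⊢-names mix₀         = ∼.refl
⊢-names (⊗ʳ {A = A} {Γ = Γ} {x = x} {B = B} {Δ = Δ} d) =
  ∼.trans (absorb (here refl)) (∷-cong refl (∼.trans (unbind-↑ 1 ((x , B) ∷ concat [ Γ ++ Δ ]))
    (unbind-cong 1 (∼.trans (names-resp-∼ (↭-sym (concat-split 1 (0 , A) (suc x , B) Γ Δ [])))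
                            (⊢-names d)))))
⊢-names (𝟏ʳ d)       = ∷-cong refl (unbind-0 (⊢-names d))
⊢-names (⅋ʳ {Γ = Γ} d) = ∼.trans (absorb (here refl)) (∷-cong refl
  (∼.trans (prefix-names Γ (unbind-↑ 1 Γ)) (unbind-cong 1 (⊢-Corresponds d))))
⊢-names (⊥ʳ {Γ = Γ} x∉ d)    = prefix-names Γ (unbind-0 (⊢-Corresponds d))
⊢-names (⊕₁ʳ d)      = absorb-subject (unbind-0 (⊢-names d))
⊢-names (⊕₂ʳ d)      = absorb-subject (unbind-0 (⊢-names d))
⊢-names (&ʳ d e)     = ∼.trans (absorb (here refl)) (∷-cong refl
  (∼.trans (∼.sym (++-idempotent _)) (++-cong (⊢-names d) (⊢-names e))))
⊢-names (‼ʳ {Γ = Γ} x∉ w d)  = prefix-names Γ (∼.trans (unbind-↑ 1 Γ) (unbind-cong 1 (⊢-Corresponds d)))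
⊢-names (⁇ʳ {Γ = Γ} x∉ d)    = prefix-names Γ (∼.trans (unbind-↑ 1 Γ) (unbind-cong 1 (⊢-Corresponds d)))
⊢-names (Wʳ {Γ = Γ} x∉ d)    = prefix-names Γ (unbind-0 (⊢-Corresponds d))
⊢-names (Cʳ {Γ = Γ} x∉ d)    = prefix-names Γ (∼.trans (unbind-↑ 2 Γ) (unbind-cong 2 (⊢-Corresponds d)))
⊢-names (∃ʳ d)       = absorb-subject (unbind-0 (⊢-names d))
⊢-names (∀ʳ {Γ = Γ} d) = ∼.trans (absorb (here refl)) (∷-cong refl (∼.trans (prefix-names Γ
  (∼.reflexive (sym (names-↑ᵀ Γ)))) (unbind-0 (⊢-Corresponds d))))
⊢-Corresponds d = ∼.trans (names-[-] _) (⊢-names d)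

-- Invariance of πLL typing under ≅ and under disentangling

-- Apart from `exch`, only `mix` types a parallel composition; the exchanges met on the way compose
-- into one re-enumeration.
mix⁻¹ : ⊢ P ∥ Q ⦂ 𝒢 → ∃[ 𝒢₁ ] ∃[ 𝒢₂ ] (𝒢₁ ++ 𝒢₂ ≋ 𝒢 × ⊢ P ⦂ 𝒢₁ × ⊢ Q ⦂ 𝒢₂)
mix⁻¹ (exch p d) with mix⁻¹ d
... | 𝒢₁ , 𝒢₂ , q , d₁ , d₂ = 𝒢₁ , 𝒢₂ , ≋.trans q p , d₁ , d₂
mix⁻¹ (mix u d e) = _ , _ , ≋.↭-refl , d , e

mix₀⁻¹ : ⊢ 𝟎 ⦂ 𝒢 → [] ≋ 𝒢
mix₀⁻¹ (exch p d) = ≋.trans (mix₀⁻¹ d) p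
mix₀⁻¹ mix₀       = ≋.↭-refl

cut⁻¹ : ⊢ ν P ⦂ 𝒢 → ∃[ A ] ∃[ Γ ] ∃[ Δ ] ∃[ ℋ ]
        ((Γ ++ Δ) ∷ ℋ ≋ 𝒢 × ⊢ P ⦂ ((0 , A) ∷ Γ ↑ 2) ∷ ((1 , A ^⊥) ∷ Δ ↑ 2) ∷ ℋ ⇑ 2)
cut⁻¹ (exch p d) with cut⁻¹ d
... | A , Γ , Δ , ℋ , q , e = A , Γ , Δ , ℋ , ≋.trans q p , e
cut⁻¹ (cut d) = _ , _ , _ , _ , ≋.↭-refl , d

infix 4 _⊑_
_⊑_ : Proc → Proc → Set
P ⊑ Q = ∀ {𝒢} → ⊢ P ⦂ 𝒢 → ⊢ Q ⦂ 𝒢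

∙-mono : ∀ {π} → P ⊑ Q → π ∙ P ⊑ π ∙ Q
∙-mono f (exch p d)  = exch p (∙-mono f d)
∙-mono f (⊗ʳ d)      = ⊗ʳ (f d)
∙-mono f (𝟏ʳ d)      = 𝟏ʳ (f d)
∙-mono f (⅋ʳ d)      = ⅋ʳ (f d)
∙-mono f (⊥ʳ x∉ d)   = ⊥ʳ x∉ (f d)
∙-mono f (⊕₁ʳ d)     = ⊕₁ʳ (f d)
∙-mono f (⊕₂ʳ d)     = ⊕₂ʳ (f d)
∙-mono f (‼ʳ x∉ w d) = ‼ʳ x∉ w (f d)
∙-mono f (⁇ʳ x∉ d)   = ⁇ʳ x∉ (f d)
∙-mono f (Wʳ x∉ d)   = Wʳ x∉ (f d)
∙-mono f (Cʳ x∉ d)   = Cʳ x∉ (f d)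
∙-mono f (∃ʳ d)      = ∃ʳ (f d)
∙-mono f (∀ʳ d)      = ∀ʳ (f d)

▷-mono : ∀ {P′ Q′} → P ⊑ P′ → Q ⊑ Q′ → x ▷⟨ P , Q ⟩ ⊑ x ▷⟨ P′ , Q′ ⟩
▷-mono f g (exch p d) = exch p (▷-mono f g d)
▷-mono f g (&ʳ d e)   = &ʳ (f d) (g e)

ν-mono : P ⊑ Q → ν P ⊑ ν Q
ν-mono f (exch p d) = exch p (ν-mono f d)
ν-mono f (cut d)    = cut (f d)

∥-mono : ∀ {P′ Q′} → P ⊑ P′ → Q ⊑ Q′ → P ∥ Q ⊑ P′ ∥ Q′
∥-mono f g (exch p d)  = exch p (∥-mono f g d)
∥-mono f g (mix u d e) = mix u (f d) (g e)

mix-≋ : 𝒢 ++ ℋ ≋ 𝒦 → Distinct 𝒦 → ⊢ P ⦂ 𝒢 → ⊢ Q ⦂ ℋ → ⊢ P ∥ Q ⦂ 𝒦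
mix-≋ p u d e = exch p (mix (Distinct-resp-≋ (≋.↭-sym p) u) d e)

-- Two inversions type the three processes separately. The regrouped inner mix is legal because it
-- concerns a part of a distinct whole.
∥-assoc⁺ : ∀ {R} → (P ∥ Q) ∥ R ⊑ P ∥ (Q ∥ R)
∥-assoc⁺ d with mix⁻¹ d
... | 𝒢₁₂ , 𝒢₃ , p , d₁₂ , d₃ with mix⁻¹ d₁₂
... | 𝒢₁ , 𝒢₂ , q , d₁ , d₂ =
  mix-≋ r (⊢-Distinct d) d₁
    (mix (Distinct-++⁻ʳ 𝒢₁ (Distinct-resp-≋ (≋.↭-sym r) (⊢-Distinct d))) d₂ d₃)
  where
  r = ≋.trans (≋.↭-sym (≋.++-assoc 𝒢₁ 𝒢₂ 𝒢₃)) (≋.trans (≋.++⁺ʳ 𝒢₃ q) p)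

∥-assoc⁻ : ∀ {R} → P ∥ (Q ∥ R) ⊑ (P ∥ Q) ∥ R
∥-assoc⁻ d with mix⁻¹ d
... | 𝒢₁ , 𝒢₂₃ , p , d₁ , d₂₃ with mix⁻¹ d₂₃
... | 𝒢₂ , 𝒢₃ , q , d₂ , d₃ =
  mix-≋ r (⊢-Distinct d)
    (mix (Distinct-++⁻ˡ (𝒢₁ ++ 𝒢₂) (Distinct-resp-≋ (≋.↭-sym r) (⊢-Distinct d))) d₁ d₂) d₃
  where
  r = ≋.trans (≋.++-assoc 𝒢₁ 𝒢₂ 𝒢₃) (≋.trans (≋.++⁺ˡ 𝒢₁ q) p)

∥-comm⁺ : P ∥ Q ⊑ Q ∥ P
∥-comm⁺ d with mix⁻¹ d
... | 𝒢₁ , 𝒢₂ , p , d₁ , d₂ = mix-≋ (≋.trans (≋.++-comm 𝒢₂ 𝒢₁) p) (⊢-Distinct d) d₂ d₁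

∥-unit⁺ : P ∥ 𝟎 ⊑ P
∥-unit⁺ d with mix⁻¹ d
... | 𝒢₁ , 𝒢₂ , p , d₁ , d₂ =
  exch (≋.trans (≋.↭-sym (≋.++-identityʳ 𝒢₁)) (≋.trans (≋.++⁺ˡ 𝒢₁ (mix₀⁻¹ d₂)) p)) d₁

∥-unit⁻ : P ⊑ P ∥ 𝟎
∥-unit⁻ {𝒢 = 𝒢} d = mix-≋ (≋.++-identityʳ 𝒢) (⊢-Distinct d) d mix₀

-- Both directions are proved together because `≅-sym` exchanges them.
≅⇒⊑ : P ≅ Q → P ⊑ Q
≅⇒⊒ : P ≅ Q → Q ⊑ P
≅⇒⊑ ≅-refl        = id
≅⇒⊑ (≅-sym e)     = ≅⇒⊒ e
≅⇒⊑ (≅-trans e f) = ≅⇒⊑ f ∘ ≅⇒⊑ e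
≅⇒⊑ ∥-assoc       = ∥-assoc⁺
≅⇒⊑ ∥-comm        = ∥-comm⁺
≅⇒⊑ ∥-unit        = ∥-unit⁺
≅⇒⊑ (∙-cong e)    = ∙-mono (≅⇒⊑ e)
≅⇒⊑ (▷-cong e f)  = ▷-mono (≅⇒⊑ e) (≅⇒⊑ f)
≅⇒⊑ (ν-cong e)    = ν-mono (≅⇒⊑ e)
≅⇒⊑ (∥-cong e f)  = ∥-mono (≅⇒⊑ e) (≅⇒⊑ f)
≅⇒⊒ ≅-refl        = id
≅⇒⊒ (≅-sym e)     = ≅⇒⊑ e
≅⇒⊒ (≅-trans e f) = ≅⇒⊒ e ∘ ≅⇒⊒ f
≅⇒⊒ ∥-assoc       = ∥-assoc⁻
≅⇒⊒ ∥-comm        = ∥-comm⁺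
≅⇒⊒ ∥-unit        = ∥-unit⁻
≅⇒⊒ (∙-cong e)    = ∙-mono (≅⇒⊒ e)
≅⇒⊒ (▷-cong e f)  = ▷-mono (≅⇒⊒ e) (≅⇒⊒ f)
≅⇒⊒ (ν-cong e)    = ν-mono (≅⇒⊒ e)
≅⇒⊒ (∥-cong e f)  = ∥-mono (≅⇒⊒ e) (≅⇒⊒ f)

-- A CP cut or tensor is a mix of its two premises followed by the πLL rule, and its uniqueness
-- condition yields the one of the mix.
⊢CP⇒⊢ : ⊢CP P ⦂ Γ → ⊢ P ⦂ [ Γ ]
⊢CP⇒⊢ (exch p d)  = exch (≋.prep p ≋.↭-refl) (⊢CP⇒⊢ d)
⊢CP⇒⊢ (conv e d)  = ≅⇒⊑ e (⊢CP⇒⊢ d)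
⊢CP⇒⊢ (ax x≢y)    = ax x≢y
⊢CP⇒⊢ (cut {Γ = Γ} {Δ = Δ} {A = A} u d e) =
  cut {𝒢 = []} (mix (Distinct-cut⁺ {Γ = Γ} {Δ = Δ} {𝒢 = []} {A = A} {B = A ^⊥} ([-]-Distinct {Γ = Γ ++ Δ} u))
                    (⊢CP⇒⊢ d) (⊢CP⇒⊢ e))
⊢CP⇒⊢ (⊗ʳ {x = x} {A = A} {B = B} {Γ = Γ} {Δ = Δ} u d e) =
  ⊗ʳ (mix (Distinct-⊗⁺ {Γ = Γ} {Δ = Δ} {A = A} {B = B} u) (⊢CP⇒⊢ d) (⊢CP⇒⊢ e))
⊢CP⇒⊢ 𝟏ʳ          = 𝟏ʳ mix₀
⊢CP⇒⊢ (⅋ʳ d)      = ⅋ʳ (⊢CP⇒⊢ d)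
⊢CP⇒⊢ (⊥ʳ x∉ d)   = ⊥ʳ x∉ (⊢CP⇒⊢ d)
⊢CP⇒⊢ (⊕₁ʳ d)     = ⊕₁ʳ (⊢CP⇒⊢ d)
⊢CP⇒⊢ (⊕₂ʳ d)     = ⊕₂ʳ (⊢CP⇒⊢ d)
⊢CP⇒⊢ (&ʳ d e)    = &ʳ (⊢CP⇒⊢ d) (⊢CP⇒⊢ e)
⊢CP⇒⊢ (‼ʳ x∉ w d) = ‼ʳ x∉ w (⊢CP⇒⊢ d)
⊢CP⇒⊢ (⁇ʳ x∉ d)   = ⁇ʳ x∉ (⊢CP⇒⊢ d)
⊢CP⇒⊢ (Wʳ x∉ d)   = Wʳ x∉ (⊢CP⇒⊢ d)
⊢CP⇒⊢ (Cʳ x∉ d)   = Cʳ x∉ (⊢CP⇒⊢ d)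
⊢CP⇒⊢ (∃ʳ d)      = ∃ʳ (⊢CP⇒⊢ d)
⊢CP⇒⊢ (∀ʳ d)      = ∀ʳ (⊢CP⇒⊢ d)

-- `par` leaves no trailing `𝟎` after a single process, so the unit law is needed.
par-∷ : ∀ P Ps → par (P ∷ Ps) ≅ P ∥ par Ps
par-∷ P []       = ≅-sym ∥-unit
par-∷ P (_ ∷ Ps) = ≅-refl

par-++ : ∀ Ps Qs → par (Ps ++ Qs) ≅ par Ps ∥ par Qs
par-++ []       Qs = ≅-trans (≅-sym ∥-unit) ∥-comm
par-++ (P ∷ Ps) Qs = ≅-trans (par-∷ P (Ps ++ Qs)) (≅-trans (∥-cong ≅-refl (par-++ Ps Qs))
  (≅-trans (≅-sym ∥-assoc) (∥-cong (≅-sym (par-∷ P Ps)) ≅-refl)))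

par-↭ : ∀ {Ps Qs} → Ps ↭ Qs → par Ps ≅ par Qs
par-↭ ↭.refl = ≅-refl
par-↭ (↭.prep {xs = Ps} {ys = Qs} P p) =
  ≅-trans (par-∷ P Ps) (≅-trans (∥-cong ≅-refl (par-↭ p)) (≅-sym (par-∷ P Qs)))
par-↭ (↭.swap {xs = Ps} {ys = Qs} P Q p) =
  ≅-trans (∥-cong ≅-refl (par-∷ Q Ps)) (≅-trans (≅-sym ∥-assoc)
  (≅-trans (∥-cong ∥-comm (par-↭ p)) (≅-trans ∥-assoc (≅-sym (∥-cong ≅-refl (par-∷ P Qs))))))
par-↭ (↭.trans p q) = ≅-trans (par-↭ p) (par-↭ q)

renᴾ-inverse : ∀ π → σ (ρ (subject π)) ≡ subject π → renᴾ σ (renᴾ ρ π) ≡ π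
renᴾ-inverse (out x)    = cong out
renᴾ-inverse (inp x)    = cong inp
renᴾ-inverse (close x)  = cong close
renᴾ-inverse (wait x)   = cong wait
renᴾ-inverse (inl x)    = cong inl
renᴾ-inverse (inr x)    = cong inr
renᴾ-inverse (outᵀ x A) = cong (λ x → outᵀ x A)
renᴾ-inverse (inpᵀ x)   = cong inpᵀ
renᴾ-inverse (serve x)  = cong serve
renᴾ-inverse (use x)    = cong use
renᴾ-inverse (dup x)    = cong dup
renᴾ-inverse (drop x)   = cong drop

bound-renᴾ : ∀ ρ π → bound (renᴾ ρ π) ≡ bound π
bound-renᴾ ρ (out x)    = refl
bound-renᴾ ρ (inp x)    = refl
bound-renᴾ ρ (close x)  = refl
bound-renᴾ ρ (wait x)   = refl
bound-renᴾ ρ (inl x)    = refl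
bound-renᴾ ρ (inr x)    = refl
bound-renᴾ ρ (outᵀ x A) = refl
bound-renᴾ ρ (inpᵀ x)   = refl
bound-renᴾ ρ (serve x)  = refl
bound-renᴾ ρ (use x)    = refl
bound-renᴾ ρ (dup x)    = refl
bound-renᴾ ρ (drop x)   = refl

-- S stands for membership in a list of free names; a predicate is easy to shift along suc.
lifts-inverse : ∀ k {S : Name → Set} → (∀ z → S (k + z) → σ (ρ z) ≡ z) →
                ∀ z → S z → lifts k σ (lifts k ρ z) ≡ z
lifts-inverse zero    i z       s = i z s
lifts-inverse (suc k) i zero    s = refl
lifts-inverse (suc k) {S} i (suc z) s = cong suc (lifts-inverse k {S ∘ suc} i z s)

-- Asking for an inverse on free names only is what allows `_∸ 2` to be undone on components that do
-- not mention the restricted names.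
ren-inverse : ∀ P → (∀ z → z ∈ fn P → σ (ρ z) ≡ z) → ren σ (ren ρ P) ≡ P
ren-inverse {σ = σ} {ρ = ρ} (π ∙ P) i rewrite bound-renᴾ ρ π =
  cong₂ _∙_ (renᴾ-inverse π (i _ (here refl)))
    (ren-inverse P (lifts-inverse (bound π) (λ z m → i z (there (∈-unbind⁺ (bound π) m)))))
ren-inverse (x ▷⟨ P , Q ⟩) i rewrite i x (here refl) =
  cong₂ (x ▷⟨_,_⟩) (ren-inverse P (λ z m → i z (there (∈-++⁺ˡ m))))
                   (ren-inverse Q (λ z m → i z (there (∈-++⁺ʳ (fn P) m))))
ren-inverse (ν P)   i = cong ν (ren-inverse P (lifts-inverse 2 (λ z m → i z (∈-unbind⁺ 2 m))))
ren-inverse (P ∥ Q) i = cong₂ _∥_ (ren-inverse P (λ z m → i z (∈-++⁺ˡ m)))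
                                  (ren-inverse Q (λ z m → i z (∈-++⁺ʳ (fn P) m)))
ren-inverse 𝟎       i = refl
ren-inverse (x ↔ y) i = cong₂ _↔_ (i x (here refl)) (i y (there (here refl)))

ren-par : ∀ Ps → ren ρ (par Ps) ≡ par (map (ren ρ) Ps)
ren-par []           = refl
ren-par (P ∷ [])     = refl
ren-par (P ∷ Q ∷ Ps) = cong (_ ∥_) (ren-par (Q ∷ Ps))

2+[z∸2]≡z : ∀ z → z ≢ 0 → z ≢ 1 → 2 + (z ∸ 2) ≡ z
2+[z∸2]≡z 0             z≢0 _   = ⊥-elim (z≢0 refl)
2+[z∸2]≡z 1             _   z≢1 = ⊥-elim (z≢1 refl)
2+[z∸2]≡z (suc (suc z)) _   _   = refl

-- `_∸ 2` identifies 0, 1 and 2, so shifting back recovers a name exactly when it is neither 0 nor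
-- 1.
unlinked-inverse : ¬ Linked P → ren (2 +_) (ren (_∸ 2) P) ≡ P
unlinked-inverse {P = P} ¬l = ren-inverse P λ z m →
  2+[z∸2]≡z z (λ { refl → ¬l (inj₁ m) }) (λ { refl → ¬l (inj₂ m) })

unlinked-inverses : ∀ {Ps} → All (¬_ ∘ Linked) Ps → map (ren (2 +_)) (map (ren (_∸ 2)) Ps) ≡ Ps
unlinked-inverses []       = refl
unlinked-inverses (l ∷ ls) = cong₂ _∷_ (unlinked-inverse l) (unlinked-inverses ls)

filter-split : ∀ {p} {C : Proc → Set p} (C? : ∀ P → Dec (C P)) Ps →
               filter C? Ps ++ filter (¬? ∘ C?) Ps ↭ Ps
filter-split C? []       = ↭-refl
filter-split C? (P ∷ Ps) with does (C? P)
... | true  = ↭-prep P (filter-split C? Ps)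
... | false = ↭-trans (Perm.shift P (filter C? Ps) _) (↭-prep P (filter-split C? Ps))

Inverse-↑ : ∀ k Γ → Inverse (_∸ k) (k +_) Γ
Inverse-↑ k Γ = All.universal (λ b → fixed (m+n∸m≡n k (proj₁ b))) Γ

-- Only ν needs an argument. Inverting the mix and the cut types the linked components under the
-- binder; the unlinked ones are shifted back under it and mixed in, so that their environments join
-- those the cut leaves alone.
dis-⊒ : ∀ P → par (dis P) ⊑ P
dis-⊒ (π ∙ P)       = ∙-mono (dis-⊒ P)
dis-⊒ (x ▷⟨ P , Q ⟩) = ▷-mono (dis-⊒ P) (dis-⊒ Q)
dis-⊒ (P ∥ Q) d     = ∥-mono (dis-⊒ P) (dis-⊒ Q) (≅⇒⊑ (par-++ (dis P) (dis Q)) d)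
dis-⊒ 𝟎             = id
dis-⊒ (x ↔ y)       = id
dis-⊒ (ν P) {𝒢} d with mix⁻¹ (≅⇒⊑ (par-∷ _ (map (ren (_∸ 2)) (filter (¬? ∘ linked?) (dis P)))) d)
... | 𝒢₁ , 𝒢₂ , p , d₁ , d₂ with cut⁻¹ d₁
... | A , Γ , Δ , ℋ , q , e = exch r (cut (dis-⊒ P (≅⇒⊑ L∥U≅dis
    (mix-≋ (≋.↭-reflexive (cong (λ 𝒢 → _ ∷ _ ∷ 𝒢) (sym (map-++ _ ℋ 𝒢₂)))) u e d₂′))))
  where
  L = filter linked? (dis P)
  U = filter (¬? ∘ linked?) (dis P)
  L∥U≅dis : par L ∥ par U ≅ par (dis P)
  L∥U≅dis = ≅-trans (≅-sym (par-++ L U)) (par-↭ (filter-split linked? (dis P)))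
  r : (Γ ++ Δ) ∷ ℋ ++ 𝒢₂ ≋ 𝒢
  r = ≋.trans (≋.++⁺ʳ 𝒢₂ q) p
  u : Distinct (((0 , A) ∷ Γ ↑ 2) ∷ ((1 , A ^⊥) ∷ Δ ↑ 2) ∷ (ℋ ++ 𝒢₂) ⇑ 2)
  u = Distinct-cut⁺ {Γ = Γ} {Δ = Δ} {𝒢 = ℋ ++ 𝒢₂} {A = A} {B = A ^⊥}
        (Distinct-resp-≋ (≋.↭-sym r) (⊢-Distinct d))
  -- Shifting the environments by 2 turns the extruded components back into the ones that stood
  -- under ν.
  d₂′ : ⊢ par U ⦂ 𝒢₂ ⇑ 2
  d₂′ = subst (λ P → ⊢ P ⦂ 𝒢₂ ⇑ 2)
          (trans (ren-par (map (ren (_∸ 2)) U))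
                 (cong par (unlinked-inverses (All.all-filter (¬? ∘ linked?) (dis P)))))
          (ren-⊢ (All.universal (Inverse-↑ 2) 𝒢₂) d₂)

-- Typing the components in CP

Typed : Env → Proc → Set
Typed Γ P = ⊢CP P ⦂ Γ

Typed-resp-≋ : ∀ {Ps} → 𝒢 ≋ ℋ → Pointwiseᴸ Typed 𝒢 Ps → ∃[ Qs ] (Ps ↭ Qs × Pointwiseᴸ Typed ℋ Qs)
Typed-resp-≋ (≋.refl [])       []       = _ , ↭-refl , []
Typed-resp-≋ (≋.refl (p ∷ ps)) (d ∷ ds) with Typed-resp-≋ (≋.refl ps) ds
... | _ , q , es = _ , ↭-prep _ q , exch p d ∷ es
Typed-resp-≋ (≋.prep p ps) (d ∷ ds) with Typed-resp-≋ ps ds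
... | _ , q , es = _ , ↭-prep _ q , exch p d ∷ es
Typed-resp-≋ (≋.swap p₁ p₂ ps) (d₁ ∷ d₂ ∷ ds) with Typed-resp-≋ ps ds
... | _ , q , es = _ , ↭-swap _ _ q , exch p₂ d₂ ∷ exch p₁ d₁ ∷ es
Typed-resp-≋ (≋.trans ps₁ ps₂) ds with Typed-resp-≋ ps₁ ds
... | _ , q₁ , es with Typed-resp-≋ ps₂ es
... | _ , q₂ , fs = _ , ↭-trans q₁ q₂ , fs

⊢CP-Corresponds : ⊢CP P ⦂ Γ → Corresponds Γ P
⊢CP-Corresponds d = ⊢-Corresponds (⊢CP⇒⊢ d)

-- Free names are those of the environment, and a shift by 2 leaves neither 0 nor 1 among them.
¬Linked-↑2 : ⊢CP P ⦂ Γ ↑ 2 → ¬ Linked P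
¬Linked-↑2 {Γ = Γ} d (inj₁ m) = 0∉↑2 Γ (from (⊢CP-Corresponds d) m)
¬Linked-↑2 {Γ = Γ} d (inj₂ m) = 1∉↑2 Γ (from (⊢CP-Corresponds d) m)

Typed-⇑2⇒¬Linked : ∀ 𝒢 {Ps} → Pointwiseᴸ Typed (𝒢 ⇑ 2) Ps → All (¬_ ∘ Linked) Ps
Typed-⇑2⇒¬Linked []      []       = []
Typed-⇑2⇒¬Linked (Γ ∷ 𝒢) (d ∷ ds) = ¬Linked-↑2 {Γ = Γ} d ∷ Typed-⇑2⇒¬Linked 𝒢 ds

renᴱ-inverse : Inverse σ ρ Γ → renᴱ σ (renᴱ ρ Γ) ≡ Γ
renᴱ-inverse []             = refl
renᴱ-inverse (fixed i ∷ is) = cong₂ _∷_ (cong (_, _) i) (renᴱ-inverse is)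

-- Here `σ` is the renaming applied: on names of the form `ρ z` it has `ρ` as its own left inverse.
ren-⊢CP-inverse : Inverse σ ρ Γ → ⊢CP P ⦂ renᴱ ρ Γ → ⊢CP ren σ P ⦂ Γ
ren-⊢CP-inverse {σ = σ} {ρ = ρ} {Γ = Γ} is d =
  ⊢CP-resp-≡ (renᴱ-inverse is)
    (ren-⊢CP {σ = ρ} {ρ = σ} (All.map⁺ (All.map (λ { (fixed i) → fixed (cong ρ i) }) is)) d)

Typed-⇑2⁻ : ∀ 𝒢 {Ps} → Pointwiseᴸ Typed (𝒢 ⇑ 2) Ps → Pointwiseᴸ Typed 𝒢 (map (ren (_∸ 2)) Ps)
Typed-⇑2⁻ []      []       = []
Typed-⇑2⁻ (Γ ∷ 𝒢) (d ∷ ds) = ren-⊢CP-inverse (Inverse-↑ 2 Γ) d ∷ Typed-⇑2⁻ 𝒢 ds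

dis-typed : ⊢ P ⦂ 𝒢 → ∃[ Ps ] (dis P ↭ Ps × Pointwiseᴸ Typed 𝒢 Ps)
-- One environment means one component, and `par` of a single process is that process. This is the
-- form needed under most prefixes.
par-dis-typed : ⊢ P ⦂ [ Γ ] → ⊢CP par (dis P) ⦂ Γ
dis-typed (exch p d) with dis-typed d
... | _ , q , ds with Typed-resp-≋ p ds
... | _ , r , es = _ , ↭-trans q r , es
dis-typed (ax x≢y) = _ , ↭-refl , ax x≢y ∷ []
dis-typed {P = ν P} (cut {Γ = Γ} {Δ = Δ} {𝒢 = 𝒢} d) with dis-typed d
... | P₁ ∷ P₂ ∷ Ps , p , d₁ ∷ d₂ ∷ ds =
  _ , ↭-prep _ (Perm.map⁺ (ren (_∸ 2)) unlinked) ,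
  -- The linked pair may be listed in the opposite order in `dis P`; `conv` absorbs this.
  conv (ν-cong (par-↭ (↭-sym linked))) (cut u d₁ d₂) ∷ Typed-⇑2⁻ 𝒢 ds
  where
  u : Unique (names (Γ ++ Δ))
  u = [-]-Unique {Γ = Γ ++ Δ} (Distinct-++⁻ˡ {ℋ = 𝒢} [ Γ ++ Δ ] (⊢-Distinct (cut {Γ = Γ} {Δ = Δ} d)))
  -- The cut names 0 and 1 head the first two environments, hence are free in `P₁` and `P₂`; all
  -- other environments are shifted by 2.
  l₁ : Linked P₁
  l₁ = inj₁ (to (⊢CP-Corresponds d₁) (here refl))
  l₂ : Linked P₂
  l₂ = inj₂ (to (⊢CP-Corresponds d₂) (here refl))
  ls : All (¬_ ∘ Linked) Ps
  ls = Typed-⇑2⇒¬Linked 𝒢 ds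
  linked : filter linked? (dis P) ↭ P₁ ∷ P₂ ∷ []
  linked = ↭-trans (Perm.filter-↭ linked? p) (↭-reflexive (
    begin
      filter linked? (P₁ ∷ P₂ ∷ Ps)  ≡⟨ filter-accept linked? l₁ ⟩
      P₁ ∷ filter linked? (P₂ ∷ Ps)  ≡⟨ cong (P₁ ∷_) (filter-accept linked? l₂) ⟩
      P₁ ∷ P₂ ∷ filter linked? Ps    ≡⟨ cong (λ Qs → P₁ ∷ P₂ ∷ Qs) (filter-none linked? ls) ⟩
      P₁ ∷ P₂ ∷ []                   ∎))
    where open ≡-Reasoning
  unlinked : filter (¬? ∘ linked?) (dis P) ↭ Ps
  unlinked = ↭-trans (Perm.filter-↭ (¬? ∘ linked?) p) (↭-reflexive (
    begin
      filter (¬? ∘ linked?) (P₁ ∷ P₂ ∷ Ps) ≡⟨ filter-reject (¬? ∘ linked?) {x = P₁} {xs = P₂ ∷ Ps} (λ ¬l → ¬l l₁) ⟩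
      filter (¬? ∘ linked?) (P₂ ∷ Ps)      ≡⟨ filter-reject (¬? ∘ linked?) {x = P₂} {xs = Ps} (λ ¬l → ¬l l₂) ⟩
      filter (¬? ∘ linked?) Ps             ≡⟨ filter-all (¬? ∘ linked?) ls ⟩
      Ps                                   ∎))
    where open ≡-Reasoning
dis-typed (mix u d e) with dis-typed d | dis-typed e
... | _ , p , ds | _ , q , es = _ , Perm.++⁺ p q , Pointwise.++⁺ ds es
dis-typed mix₀ = _ , ↭-refl , []
dis-typed (⊗ʳ {A = A} {Γ = Γ} {x = x} {B = B} {Δ = Δ} d) with dis-typed d
... | _ , p , d₁ ∷ d₂ ∷ [] =
  _ , ↭-refl , conv (∙-cong (par-↭ (↭-sym p)))
    (⊗ʳ (Distinct-⊗⁻ {A = A} {Γ = Γ} {B = B} {Δ = Δ} (⊢-Distinct d)) d₁ d₂) ∷ []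
dis-typed {P = close x ∙ P} (𝟏ʳ d) with dis-typed d
-- With no environments there are no components, so the continuation becomes the `𝟎` that CP
-- requires.
... | [] , p , [] = _ , ↭-refl ,
  subst (λ Ps → ⊢CP close x ∙ par Ps ⦂ _) (sym (Perm.↭-empty-inv p)) 𝟏ʳ ∷ []
dis-typed (⅋ʳ d)      = _ , ↭-refl , ⅋ʳ (par-dis-typed d) ∷ []
dis-typed (⊥ʳ x∉ d)   = _ , ↭-refl , ⊥ʳ x∉ (par-dis-typed d) ∷ []
dis-typed (⊕₁ʳ d)     = _ , ↭-refl , ⊕₁ʳ (par-dis-typed d) ∷ []
dis-typed (⊕₂ʳ d)     = _ , ↭-refl , ⊕₂ʳ (par-dis-typed d) ∷ []
dis-typed (&ʳ d e)    = _ , ↭-refl , &ʳ (par-dis-typed d) (par-dis-typed e) ∷ []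
dis-typed (‼ʳ x∉ w d) = _ , ↭-refl , ‼ʳ x∉ w (par-dis-typed d) ∷ []
dis-typed (⁇ʳ x∉ d)   = _ , ↭-refl , ⁇ʳ x∉ (par-dis-typed d) ∷ []
dis-typed (Wʳ x∉ d)   = _ , ↭-refl , Wʳ x∉ (par-dis-typed d) ∷ []
dis-typed (Cʳ x∉ d)   = _ , ↭-refl , Cʳ x∉ (par-dis-typed d) ∷ []
dis-typed (∃ʳ d)      = _ , ↭-refl , ∃ʳ (par-dis-typed d) ∷ []
dis-typed (∀ʳ d)      = _ , ↭-refl , ∀ʳ (par-dis-typed d) ∷ []
par-dis-typed d with dis-typed d
... | _ , p , e ∷ [] = subst (λ Ps → ⊢CP par Ps ⦂ _) (sym (Perm.↭-singleton-inv p)) e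

-- Packing

-- A left inverse of `capture z` everywhere. It sends both 0 and `suc z` to `z`, so it is a right
-- inverse only away from `suc z`.
release : Name → Name → Name
release z zero    = z
release z (suc w) = w

release-capture : ∀ z w → release z (capture z w) ≡ w
release-capture z w with w ≟ z
... | yes w≡z = sym w≡z
... | no  _   = refl

capture-≡ : ∀ z → capture z z ≡ 0
capture-≡ z with z ≟ z
... | yes _  = refl
... | no z≢z = ⊥-elim (z≢z refl)

capture-≢ : ∀ {z w} → w ≢ z → capture z w ≡ suc w
capture-≢ {z} {w} w≢z with w ≟ z
... | yes w≡z = ⊥-elim (w≢z w≡z)
... | no  _   = refl

capture-∉ : ∀ {z} Γ → z ∉ names Γ → renᴱ (capture z) Γ ≡ Γ ↑ 1
capture-∉ []            z∉ = refl
capture-∉ ((w , _) ∷ Γ) z∉ =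
  cong₂ _∷_ (cong (_, _) (capture-≢ λ w≡z → z∉ (here (sym w≡z)))) (capture-∉ Γ (z∉ ∘ there))

release-∉ : ∀ {z} Γ → z ∉ names Γ → Inverse (capture z) (release z) (Γ ↑ 1)
release-∉ []            z∉ = []
release-∉ ((w , _) ∷ Γ) z∉ =
  fixed (capture-≢ λ w≡z → z∉ (here (sym w≡z))) ∷ release-∉ Γ (z∉ ∘ there)

Unique-shift : ∀ y z Γ Δ → Unique (y ∷ names ((z , A) ∷ Γ ++ Δ)) → Unique (y ∷ names (Γ ++ (z , A) ∷ Δ))
Unique-shift {A = A} y z Γ Δ = Unique-resp-↭ (↭-prep y (Perm.map⁺ proj₁ (↭-sym (Perm.shift (z , A) Γ Δ))))

∉-names-++⁻ʳ : ∀ Γ → x ∉ names (Γ ++ Δ) → x ∉ names Δ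
∉-names-++⁻ʳ {Δ = Δ} Γ x∉ m = x∉ (subst (_ ∈_) (sym (names-++ Γ Δ)) (∈-++⁺ʳ (names Γ) m))

-- The extra `Δ` is for the induction: names captured by the outer inputs are still free in the
-- inner packing.
pack⅋-typed : ∀ y Γ Δ → Unique (y ∷ names (Γ ++ Δ)) → ⊢CP P ⦂ Γ ++ Δ → ⊢CP pack⅋ y Γ P ⦂ (y , Par Γ) ∷ Δ
pack⅋-typed y [] Δ (y∉ ∷ _) d = ⊥ʳ (All.All¬⇒¬Any y∉) d
pack⅋-typed y ((z , A) ∷ Γ) Δ u@((y≢z ∷ _) ∷ z∉ ∷ _) d =
  -- Capturing `z` makes it 0 and shifts all other names, `y` included; swapping the first two
  -- entries gives the premise of (⅋).
  ⅋ʳ (exch (↭-swap _ _ ↭-refl) (⊢CP-resp-≡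
    (cong₂ _∷_ (cong (_, Par Γ) (capture-≢ y≢z))
           (cong₂ (λ z Θ → (z , A) ∷ Θ) (capture-≡ z) (capture-∉ Δ z∉Δ)))
    (ren-⊢CP {σ = release z} (All.universal (λ b → fixed (release-capture z (proj₁ b))) _)
      (pack⅋-typed y Γ ((z , A) ∷ Δ) (Unique-shift y z Γ Δ u) (exch (↭-sym (Perm.shift (z , A) Γ Δ)) d)))))
  where z∉Δ = ∉-names-++⁻ʳ Γ (All.All¬⇒¬Any z∉)

Par-↑ : ∀ k Γ → Par (Γ ↑ k) ≡ Par Γ
Par-↑ k []            = refl
Par-↑ k ((_ , A) ∷ Γ) = cong (A ⅋_) (Par-↑ k Γ)

Unique-0∷↑1 : Distinct (Γ ∷ 𝒢) → Unique (0 ∷ names (Γ ↑ 1 ++ []))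
Unique-0∷↑1 {Γ = Γ} {𝒢 = 𝒢} u rewrite ++-identityʳ (Γ ↑ 1) =
  Unique-∷ (0∉↑1 Γ) (Unique-↑⁺ 1 Γ ([-]-Unique {Γ = Γ} (Distinct-++⁻ˡ {ℋ = 𝒢} [ Γ ] u)))

pack⊗-typed : ∀ x 𝒢 {Ps} → Distinct 𝒢 → Pointwise Typed (fromList 𝒢) Ps → ⊢CP pack⊗ x 𝒢 Ps ⦂ [ x , ⨂ 𝒢 ]
pack⊗-typed x []      u []       = 𝟏ʳ
-- The packing context writes the rest of the tensor first, whereas the rule takes the component of
-- the bound name first.
pack⊗-typed x (Γ ∷ 𝒢) u (d ∷ ds) = conv (∙-cong ∥-comm) (⊗ʳ {Γ = []} {Δ = []} ([] ∷ [])
  (⊢CP-resp-≡ (cong (λ A → [ 0 , A ]) (Par-↑ 1 Γ)) (pack⅋-typed 0 (Γ ↑ 1) [] (Unique-0∷↑1 {𝒢 = 𝒢} u)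
    (⊢CP-resp-≡ (sym (++-identityʳ (Γ ↑ 1))) (ren-⊢CP (Inverse-↑ 1 Γ) d))))
  (ren-⊢CP (Inverse-↑ 1 [ x , ⨂ 𝒢 ]) (pack⊗-typed x 𝒢 (Distinct-++⁻ʳ {ℋ = 𝒢} [ Γ ] u) ds)))

toVec : ∀ {R : Env → Proc → Set} {Ps} → Pointwiseᴸ R 𝒢 Ps →
        ∃[ Qs ] (toList {n = length 𝒢} Qs ≡ Ps × Pointwise R (fromList 𝒢) Qs)
toVec []       = [] , refl , []
toVec (r ∷ rs) with toVec rs
... | Qs , eq , ss = _ ∷ Qs , cong (_ ∷_) eq , r ∷ ss

⊢⇒pack : ∀ x → Distinct 𝒢 → ⊢ P ⦂ 𝒢 → ∃[ Q ] (Pack x P 𝒢 Q × (⊢CP Q ⦂ [ x , ⨂ 𝒢 ]))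
⊢⇒pack x u d with dis-typed d
... | _ , p , ds with toVec ds
... | Ps , refl , es = _ , pack Ps p (PointwiseV.map ⊢CP-Corresponds es) , pack⊗-typed x _ u es

-- Unpacking by inversion in πLL

-- By uniqueness of names, the permutation can match the entry of `y` only with the entry of `y`.
∷-↭⁻¹ : ∀ {y C D Γ Δ} → Unique (names ((y , D) ∷ Δ)) → (y , C) ∷ Γ ↭ (y , D) ∷ Δ → C ≡ D × Γ ↭ Δ
∷-↭⁻¹ (y∉ ∷ _) p with Perm.∈-resp-↭ p (here refl)
... | here refl = refl , Perm.drop-∷ p
... | there m   = ⊥-elim (All.All¬⇒¬Any y∉ (∈-map⁺ proj₁ m))

[-]-≋⁻¹ : [ Γ ] ≋ [ Δ ] → Γ ↭ Δ
[-]-≋⁻¹ {Γ} {Δ} p =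
  ↭-trans (↭-reflexive (sym (++-identityʳ Γ))) (↭-trans (concat-≋ p) (↭-reflexive (++-identityʳ Δ)))

⊥ʳ-inv : ⊢ wait x ∙ P ⦂ 𝒢 → ∃[ Γ ] ([ (x , ⊥) ∷ Γ ] ≋ 𝒢 × ⊢ P ⦂ [ Γ ])
⊥ʳ-inv (exch p d) with ⊥ʳ-inv d
... | Γ , q , e = Γ , ≋.trans q p , e
⊥ʳ-inv (⊥ʳ x∉ d) = _ , ≋.↭-refl , d

⅋ʳ-inv : ⊢ inp x ∙ P ⦂ 𝒢 →
         ∃[ A ] ∃[ B ] ∃[ Γ ] ([ (x , A ⅋ B) ∷ Γ ] ≋ 𝒢 × ⊢ P ⦂ [ (0 , A) ∷ (suc x , B) ∷ Γ ↑ 1 ])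
⅋ʳ-inv (exch p d) with ⅋ʳ-inv d
... | A , B , Γ , q , e = A , B , Γ , ≋.trans q p , e
⅋ʳ-inv (⅋ʳ d) = _ , _ , _ , ≋.↭-refl , d

⊗ʳ-inv : ⊢ out x ∙ P ⦂ 𝒢 →
         ∃[ A ] ∃[ B ] ∃[ Γ ] ∃[ Δ ] ([ (x , A ⊗ B) ∷ Γ ++ Δ ] ≋ 𝒢
           × ⊢ P ⦂ ((0 , A) ∷ Γ ↑ 1) ∷ ((suc x , B) ∷ Δ ↑ 1) ∷ [])
⊗ʳ-inv (exch p d) with ⊗ʳ-inv d
... | A , B , Γ , Δ , q , e = A , B , Γ , Δ , ≋.trans q p , e
⊗ʳ-inv (⊗ʳ d) = _ , _ , _ , _ , ≋.↭-refl , d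

⊥ʳ⁻¹ : ⊢ wait x ∙ P ⦂ [ (x , ⊥) ∷ Γ ] → ⊢ P ⦂ [ Γ ]
⊥ʳ⁻¹ d with ⊥ʳ-inv d
... | _ , p , e with ∷-↭⁻¹ (⊢-Unique d) ([-]-≋⁻¹ p)
... | _ , q = exch (≋.prep q ≋.↭-refl) e

⅋ʳ⁻¹ : ⊢ inp x ∙ P ⦂ [ (x , A ⅋ B) ∷ Γ ] → ⊢ P ⦂ [ (0 , A) ∷ (suc x , B) ∷ Γ ↑ 1 ]
⅋ʳ⁻¹ d with ⅋ʳ-inv d
... | _ , _ , _ , p , e with ∷-↭⁻¹ (⊢-Unique d) ([-]-≋⁻¹ p)
... | refl , q = exch (≋.prep (↭-prep _ (↭-prep _ (Perm.map⁺ _ q))) ≋.↭-refl) e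

⊗ʳ⁻¹ : ⊢ out x ∙ P ⦂ [ [ x , A ⊗ B ] ] → ⊢ P ⦂ [ 0 , A ] ∷ [ suc x , B ] ∷ []
⊗ʳ⁻¹ d with ⊗ʳ-inv d
-- The conclusion holds the subject alone, which forces `Γ` and `Δ` to be empty.
... | _ , _ , Γ , Δ , p , e with Γ | Δ | Perm.↭-singleton-inv ([-]-≋⁻¹ p)
... | [] | [] | refl = e

-- Inverting the mix leaves open how the two environments are shared out. Each process has a free
-- name, so neither side gets none, and that name tells which one it gets.
mix⁻¹-singletons : ∀ {y} → x ≢ y → x ∈ fn P → y ∈ fn Q → ⊢ P ∥ Q ⦂ [ x , A ] ∷ [ y , B ] ∷ [] →
                   ⊢ P ⦂ [ [ x , A ] ] × ⊢ Q ⦂ [ [ y , B ] ]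
mix⁻¹-singletons {x} {P} {Q} {A} {B} {y} x≢y x∈ y∈ d with mix⁻¹ d
... | 𝒢₁ , 𝒢₂ , p , d₁ , d₂ =
  -- Two invariants of the permutation suffice: the length 2, and that every environment is one of
  -- the two singletons.
  split 𝒢₁ 𝒢₂ d₁ d₂ (from (⊢-names d₁) x∈) (from (⊢-names d₂) y∈) (≋.xs↭ys⇒|xs|≡|ys| p)
    (≋.All-resp-↭ Member-resp-↭ (≋.↭-sym p) (inj₁ refl ∷ inj₂ refl ∷ []))
  where
  Member : Env → Set
  Member Γ = Γ ≡ [ x , A ] ⊎ Γ ≡ [ y , B ]

  Member-resp-↭ : Γ ↭ Δ → Member Γ → Member Δ
  Member-resp-↭ q (inj₁ refl) = inj₁ (Perm.↭-singleton-inv (↭-sym q))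
  Member-resp-↭ q (inj₂ refl) = inj₂ (Perm.↭-singleton-inv (↭-sym q))

  split : ∀ 𝒢₁ 𝒢₂ → ⊢ P ⦂ 𝒢₁ → ⊢ Q ⦂ 𝒢₂ → x ∈ names (concat 𝒢₁) → y ∈ names (concat 𝒢₂) →
          length (𝒢₁ ++ 𝒢₂) ≡ 2 → All Member (𝒢₁ ++ 𝒢₂) → ⊢ P ⦂ [ [ x , A ] ] × ⊢ Q ⦂ [ [ y , B ] ]
  split (_ ∷ []) (_ ∷ []) d₁ d₂ _           _           _ (inj₁ refl ∷ inj₂ refl ∷ []) = d₁ , d₂
  split (_ ∷ []) (_ ∷ []) _  _  _           (here refl) _ (_ ∷ inj₁ refl ∷ [])         = ⊥-elim (x≢y refl)
  split (_ ∷ []) (_ ∷ []) _  _  (here refl) _           _ (inj₂ refl ∷ _ ∷ [])         = ⊥-elim (x≢y refl)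
  split (_ ∷ _ ∷ [])    (_ ∷ _) _ _ _ _ ()
  split (_ ∷ _ ∷ _ ∷ _) _       _ _ _ _ ()
  split (_ ∷ [])        (_ ∷ _ ∷ _) _ _ _ _ ()

ren-⊢-inverse : Inverse σ ρ Γ → ⊢ P ⦂ [ renᴱ ρ Γ ] → ⊢ ren σ P ⦂ [ Γ ]
ren-⊢-inverse {σ = σ} {ρ = ρ} is d =
  ⊢-resp-≡ (cong [_] (renᴱ-inverse is))
    (ren-⊢ {σ = ρ} {ρ = σ} (All.map⁺ (All.map (λ { (fixed i) → fixed (cong ρ i) }) is) ∷ []) d)

-- Inverting (⅋) types the inner packing with `z` captured, and renaming by `release z` frees it
-- again. `Δ` collects the freed names.
unpack⅋ : ∀ y Γ Δ → Unique (y ∷ names (Γ ++ Δ)) → ⊢ pack⅋ y Γ P ⦂ [ (y , Par Γ) ∷ Δ ] → ⊢ P ⦂ [ Γ ++ Δ ]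
unpack⅋ y [] Δ u d = ⊥ʳ⁻¹ d
unpack⅋ {P = P} y ((z , A) ∷ Γ) Δ u@((y≢z ∷ _) ∷ z∉ ∷ _) d =
  exch (≋.prep (Perm.shift (z , A) Γ Δ) ≋.↭-refl) (unpack⅋ y Γ ((z , A) ∷ Δ) (Unique-shift y z Γ Δ u)
    (subst (λ P → ⊢ P ⦂ [ (y , Par Γ) ∷ (z , A) ∷ Δ ])
      (ren-inverse (pack⅋ y Γ P) (λ w _ → release-capture z w))
      (exch (≋.prep (↭-swap _ _ ↭-refl) ≋.↭-refl)
        (⊢-resp-≡ (cong (λ Θ → [ (z , A) ∷ (y , Par Γ) ∷ Θ ])
                        (renᴱ-inverse {σ = release z} {ρ = suc} (All.universal (λ _ → fixed refl) Δ)))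
          -- Distinctness keeps `suc z` out of this environment, so `release z` is invertible on it.
          (ren-⊢ {σ = capture z} {ρ = release z}
            ((fixed (capture-≡ z) ∷ fixed (capture-≢ y≢z) ∷ release-∉ Δ z∉Δ) ∷ []) (⅋ʳ⁻¹ d))))))
  where z∉Δ = ∉-names-++⁻ʳ Γ (All.All¬⇒¬Any z∉)

subject-pack⊗ : ∀ 𝒢 Ps → suc x ∈ fn (ren suc (pack⊗ x 𝒢 Ps))
subject-pack⊗ []      []      = here refl
subject-pack⊗ (_ ∷ _) (_ ∷ _) = here refl

subject-pack⅋ : ∀ y Γ → y ∈ fn (pack⅋ y Γ P)
subject-pack⅋ y []      = here refl
subject-pack⅋ y (_ ∷ _) = here refl

unpack⊗ : ∀ x 𝒢 Ps → Distinct 𝒢 → ⊢ pack⊗ x 𝒢 Ps ⦂ [ [ x , ⨂ 𝒢 ] ] → ⊢ par (toList Ps) ⦂ 𝒢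
unpack⊗ x []      []       u d = mix₀
unpack⊗ x (Γ ∷ 𝒢) (P ∷ Ps) u d
  -- The subjects 0 and `suc x` of the two packings identify their environments; commuting puts the
  -- bound name first, as in (⊗).
  with mix⁻¹-singletons (λ ()) (subject-pack⅋ 0 (Γ ↑ 1)) (subject-pack⊗ 𝒢 Ps) (∥-comm⁺ (⊗ʳ⁻¹ d))
... | d₁ , d₂ = ≅⇒⊒ (par-∷ P (toList Ps)) (mix u
  (subst (λ P → ⊢ P ⦂ [ Γ ]) (unsuc P) (ren-⊢-inverse (Inverse-↑ 1 Γ)
    (⊢-resp-≡ (cong [_] (++-identityʳ (Γ ↑ 1)))
      (unpack⅋ 0 (Γ ↑ 1) [] (Unique-0∷↑1 {𝒢 = 𝒢} u)
        (⊢-resp-≡ (cong (λ A → [ [ 0 , A ] ]) (sym (Par-↑ 1 Γ))) d₁)))))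
  (unpack⊗ x 𝒢 Ps (Distinct-++⁻ʳ {ℋ = 𝒢} [ Γ ] u)
    (subst (λ P → ⊢ P ⦂ [ [ x , ⨂ 𝒢 ] ]) (unsuc (pack⊗ x 𝒢 Ps))
      (ren-⊢-inverse (Inverse-↑ 1 [ x , ⨂ 𝒢 ]) d₂))))
  where
  unsuc : ∀ P → ren (_∸ 1) (ren suc P) ≡ P
  unsuc P = ren-inverse P (λ _ _ → refl)

pack⇒⊢ : ∀ {x Q} → Distinct 𝒢 → Pack x P 𝒢 Q → ⊢CP Q ⦂ [ x , ⨂ 𝒢 ] → ⊢ P ⦂ 𝒢
pack⇒⊢ {P = P} u (pack Ps p _) d = dis-⊒ P (≅⇒⊒ (par-↭ p) (unpack⊗ _ _ Ps u (⊢CP⇒⊢ d)))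

theorem4p22 : (P : Proc) (𝒢 : HyperEnv) (x : Name) →
    Distinct 𝒢 → x ∉ fn P →
    (⊢ P ⦂ 𝒢) ⇔ (∃[ Q ] (Pack x P 𝒢 Q × (⊢CP Q ⦂ [ x , ⨂ 𝒢 ])))
theorem4p22 P 𝒢 x u _ = mk⇔ (⊢⇒pack x u) λ (Q , p , d) → pack⇒⊢ u p d
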